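{- Let $d > 2$ be an integer. There exists a constant $C > 0$, depending at most on $d$ (in particular independent of $q$ and $E$), such that the following holds. Let $q$ be an integer with prime decomposition $q = p_1^{\alpha_1} \cdots p_k^{\alpha_k}$, where $k \geq 1$, $2 < p_1 < \dots < p_k$ are primes and $\alpha_i > 0$ for each $i = 1, \dots, k$. Let $\tau(q) = \sum_{e \mid q} 1$ be the number of positive divisors of $q$. If $E \subset \mathbb{Z}_q^d$ satisfies $$|E| \geq C\, \tau(q)\, q^d\, p_1^{ -\frac{d-2}{2}},$$ then $\Delta(E) = \mathbb{Z}_q$.
   Context: $\mathbb{Z}_q$ denotes the ring of integers modulo $q$, and $\mathbb{Z}_q^d = \mathbb{Z}_q \times \dots \times \mathbb{Z}_q$ is the free module of rank $d$ over $\mathbb{Z}_q$. For $x = (x_1,\dots,x_d) \in \mathbb{Z}_q^d$ put $\|x\| = x_1^2 + \dots + x_d^2 \in \mathbb{Z}_q$. For $E \subset \mathbb{Z}_q^d$, the distance set is $\Delta(E) = \{\|x-y\| : x, y \in E\} = \{(x_1-y_1)^2 + \dots + (x_d-y_d)^2 : x,y \in E\} \subset \mathbb{Z}_q$. -}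

module Defs where

open import Data.Nat.Base using (ℕ; suc; NonZero)
import Data.Nat.Base as ℕ
open import Data.Nat.DivMod using (_mod_)
open import Data.Nat.Divisibility using (_∣?_)
open import Data.Fin.Base using (Fin; toℕ)
open import Data.Integer.Base using (+_)
open import Data.Rational.Base using (ℚ; _/_)
import Data.Rational.Base as ℚ
open import Data.List.Base using (List; length; filter; map; upTo)
open import Data.List.Membership.Propositional using (_∈_)
open import Data.Vec.Base using (Vec; []; _∷_; zipWith)
import Data.Vec.Functional as F
open import Data.Product.Base using (∃₂; _×_)
open import Level using (0ℓ)
open import Relation.Unary using (Pred)
open import Relation.Binary.PropositionalEquality.Core using (_≡_)

-- ℤ/ q is represented by the least non-negative residues; every operation
-- computes on representatives in ℕ and reduces the result modulo q.
ℤ/_ : ℕ → Set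
ℤ/ q = Fin q

module _ {q : ℕ} .{{_ : NonZero q}} where

  infixl 6 _+ₘ_ _-ₘ_
  infixl 7 _*ₘ_

  0ₘ : ℤ/ q
  0ₘ = 0 mod q

  _+ₘ_ _*ₘ_ _-ₘ_ : ℤ/ q → ℤ/ q → ℤ/ q

  x +ₘ y = (toℕ x ℕ.+ toℕ y) mod q
  x *ₘ y = (toℕ x ℕ.* toℕ y) mod q
  -- The truncated subtraction is exact, since toℕ y < q.
  x -ₘ y = (toℕ x ℕ.+ (q ℕ.∸ toℕ y)) mod q

  ‖_‖ : ∀ {d} → Vec (ℤ/ q) d → ℤ/ q
  ‖ [] ‖     = 0ₘ
  ‖ x ∷ xs ‖ = x *ₘ x +ₘ ‖ xs ‖

  -- Subsets of the finite module (ℤ/ q)^d are given by lists of their elements.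
  Δ : ∀ {d} → List (Vec (ℤ/ q) d) → Pred (ℤ/ q) 0ℓ
  Δ E t = ∃₂ λ x y → x ∈ E × y ∈ E × t ≡ ‖ zipWith _-ₘ_ x y ‖

τ : ℕ → ℕ
τ n = length (filter (_∣? n) (map suc (upTo n)))

∏ : ∀ {n} → (Fin n → ℕ) → ℕ
∏ = F.foldr ℕ._*_ 1

fromℕ : ℕ → ℚ
fromℕ n = + n / 1

-- For C ≥ 0, p > 0 and d ≥ 2 this is  size ≥ C · τ(q) · q^d · p^(-(d-2)/2).  Both
-- sides are non-negative, so the inequality is multiplied by p^((d-2)/2) and
-- squared to avoid a possibly irrational square root.  A rational C suffices to
-- assert that some positive real constant works, as C may always be enlarged.
LargeEnough : (C : ℚ) (d q p size : ℕ) → Set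
LargeEnough C d q p size =
  bound ℚ.* bound ℚ.≤ fromℕ (size ℕ.^ 2 ℕ.* p ℕ.^ (d ℕ.∸ 2))
  where
  bound : ℚ
  bound = C ℚ.* fromℕ (τ q ℕ.* q ℕ.^ d)

{-# OPTIONS --safe #-}

-- Writing [m ∣ u] for 0 or 1, the indicator q · [q ∣ u] is the sum over e ∣ q of the Ramanujan sums
-- c e u, so q times the number of pairs v, w ∈ E with ‖v − w‖ = t is ∑ S(e) over e ∣ q, where
-- S(e) = ∑ c e (‖v − w‖ − t) over v, w ∈ E.  The main term is S(1) = |E|².  For m ∣ q, m > 1, write
-- ‖v − w‖ = φ(v, w) + ‖w‖, apply Cauchy–Schwarz in w, and enlarge the sum of squares to all
-- w ∈ ℤ_q^d and all residues of t − ‖w‖ modulo m.  Opening the square, the correlation formula and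
-- the cancellation of c m along the linear form 2 (v′ − v) · w leave only pairs v ≡ v′ modulo m
-- (q is odd), of which there are at most |E| (q/m)^d, so that m^(d-2) S(m)² ≤ |E|² q^(2d).  Every
-- such m is at least p₁; summing over the τ(q) − 1 values of m shows that C = 1 is admissible.  The
-- Ramanujan sums are integers, hence no complex characters are needed.

module Submission where

open import Defs
open import Data.Bool.Base using (if_then_else_)
open import Data.Empty using (⊥)
open import Data.Fin.Base as Fin using (Fin; zero; toℕ) renaming (_<_ to _<ᶠ_)
open import Data.Fin.Properties using (toℕ<n; toℕ-fromℕ<; toℕ-injective)
open import Data.Integer.Base as ℤ using (ℤ; +_; 0ℤ; 1ℤ; _+_; _*_; _-_; -_; _≤_; +≤+; ∣_∣)
open import Data.Integer.Divisibility.Signed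
open import Data.Integer.DivMod using (_%ℕ_; _/ℕ_; n%ℕd<d; a≡a%ℕn+[a/ℕn]*n)
import Data.Integer.Properties as ℤ
open import Data.Integer.Tactic.RingSolver using (solve-∀)
open import Data.List.Base using
  (List; []; _∷_; _++_; length; map; upTo; applyUpTo; allFin; tabulate; cartesianProductWith; filter)
open import Data.List.Membership.Propositional using (_∈_)
open import Data.List.Membership.Propositional.Properties using
  (∈-upTo⁺; ∈-upTo⁻; ∈-applyUpTo⁻; ∈-allFin; ∈-cartesianProductWith⁺; ∈-∃++;
   ∈-++⁻; ∈-++⁺ˡ; ∈-++⁺ʳ; ∈-filter⁻; ∈-map⁻)
open import Data.List.Properties using (upTo-∷ʳ; map-upTo; length-upTo; map-tabulate; filter-accept)
open import Data.List.Relation.Unary.All as All using (_∷_)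
open import Data.List.Relation.Unary.AllPairs using ([]; _∷_)
open import Data.List.Relation.Unary.Any using (here; there)
open import Data.List.Relation.Unary.Unique.Propositional using (Unique)
open import Data.Nat.Base as ℕ using
  (ℕ; zero; suc; pred; _<_; _^_; s≤s; z≤n; NonZero; NonTrivial; nonTrivial⇒nonZero; nonTrivial⇒≢1)
open import Data.Nat.Coprimality using (Coprime; coprime-divisor)
import Data.Nat.Divisibility as ℕ
open import Data.Nat.DivMod using (_mod_; m≡m%n+[m/n]*n)
open import Data.Nat.GCD using
  (gcd; gcd-GCD; gcd[m,n]∣m; gcd[m,n]∣n; gcd-greatest; gcd[m,n]≢0; module Bézout)
open import Data.Nat.Induction using (<-rec)
open import Data.Nat.ListAction using (product)
open import Data.Nat.Primality using
  (Prime; _Rough_; rough-1; euclidsLemma; prime⇒rough; prime⇒nonTrivial; rough∧∣⇒rough; rough⇒≤)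
open import Data.Nat.Primality.Factorisation using (factorise; module PrimeFactorisation)
import Data.Nat.Properties as ℕ
open import Data.Product.Base using (∃-syntax; _×_; _,_)
open import Data.Rational.Base as ℚ using (ℚ; 0ℚ; 1ℚ; toℚᵘ) renaming (_<_ to _<ℚ_)
import Data.Rational.Properties as ℚ
open import Data.Rational.Unnormalised.Base as ℚᵘ using (mkℚᵘ)
import Data.Rational.Unnormalised.Properties as ℚᵘ
open import Data.Sum.Base using (inj₁; inj₂)
open import Data.Unit.Base using (tt)
open import Data.Vec.Base using (Vec; []; _∷_; zipWith)
open import Function.Base using (_∘_; id)
open import Relation.Binary.PropositionalEquality
open import Relation.Nullary using (Dec; ¬_; yes; no; does; contradiction)
open import Relation.Nullary.Decidable using (decidable-stable)
open import Relation.Unary using (U; _≐_)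
open import Algebra.Properties.AbelianGroup ℤ.+-0-abelianGroup using () renaming (∙-cancelˡ to +-cancelˡ)
open import Algebra.Properties.CommutativeSemigroup ℤ.*-commutativeSemigroup using (x∙yz≈y∙xz)

-- Finite sums of integers over lists.

private variable
  A B C : Set
  F G : A → ℤ

∑ : List A → (A → ℤ) → ℤ
∑ []       F = 0ℤ
∑ (x ∷ xs) F = F x + ∑ xs F

infix 5 ∑
syntax ∑ xs (λ x → e) = ∑[ x ∈ xs ] e

∑-cong-∈ : (xs : List A) → (∀ {x} → x ∈ xs → F x ≡ G x) → ∑ xs F ≡ ∑ xs G
∑-cong-∈ []       F≡G = refl
∑-cong-∈ (x ∷ xs) F≡G = cong₂ _+_ (F≡G (here refl)) (∑-cong-∈ xs (λ x∈ → F≡G (there x∈)))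

∑-cong : (xs : List A) → (∀ x → F x ≡ G x) → ∑ xs F ≡ ∑ xs G
∑-cong xs F≡G = ∑-cong-∈ xs (λ {x} _ → F≡G x)

∑-mono-∈ : (xs : List A) → (∀ {x} → x ∈ xs → F x ≤ G x) → ∑ xs F ≤ ∑ xs G
∑-mono-∈ []       F≤G = ℤ.≤-refl
∑-mono-∈ (x ∷ xs) F≤G = ℤ.+-mono-≤ (F≤G (here refl)) (∑-mono-∈ xs (λ x∈ → F≤G (there x∈)))

∑-mono : (xs : List A) → (∀ x → F x ≤ G x) → ∑ xs F ≤ ∑ xs G
∑-mono xs F≤G = ∑-mono-∈ xs (λ {x} _ → F≤G x)

∑-zero : (xs : List A) → (∀ {x} → x ∈ xs → F x ≡ 0ℤ) → ∑ xs F ≡ 0ℤ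
∑-zero []       F≡0 = refl
∑-zero (x ∷ xs) F≡0 = cong₂ _+_ (F≡0 (here refl)) (∑-zero xs (λ x∈ → F≡0 (there x∈)))

∑-nonneg : (xs : List A) → (∀ x → 0ℤ ≤ F x) → 0ℤ ≤ ∑ xs F
∑-nonneg []       F≥0 = ℤ.≤-refl
∑-nonneg (x ∷ xs) F≥0 = ℤ.+-mono-≤ (F≥0 x) (∑-nonneg xs F≥0)

∑-distrib-+ : (xs : List A) (F G : A → ℤ) → ∑[ x ∈ xs ] (F x + G x) ≡ ∑ xs F + ∑ xs G
∑-distrib-+ []       F G = refl
∑-distrib-+ (x ∷ xs) F G =
  trans (cong (_+_ (F x + G x)) (∑-distrib-+ xs F G)) (interchange (F x) (G x) (∑ xs F) (∑ xs G))
  where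
  interchange : ∀ a b c d → a + b + (c + d) ≡ a + c + (b + d)
  interchange = solve-∀

∑-distribˡ-* : (xs : List A) (k : ℤ) (F : A → ℤ) → ∑[ x ∈ xs ] (k * F x) ≡ k * ∑ xs F
∑-distribˡ-* []       k F = sym (ℤ.*-zeroʳ k)
∑-distribˡ-* (x ∷ xs) k F =
  trans (cong (_+_ (k * F x)) (∑-distribˡ-* xs k F)) (sym (ℤ.*-distribˡ-+ k (F x) (∑ xs F)))

∑-distribʳ-* : (xs : List A) (k : ℤ) (F : A → ℤ) → ∑[ x ∈ xs ] (F x * k) ≡ ∑ xs F * k
∑-distribʳ-* xs k F =
  trans (∑-cong xs (λ x → ℤ.*-comm (F x) k)) (trans (∑-distribˡ-* xs k F) (ℤ.*-comm k (∑ xs F)))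

∑-const : (xs : List A) (k : ℤ) → ∑[ _ ∈ xs ] k ≡ + length xs * k
∑-const []       k = sym (ℤ.*-zeroˡ k)
∑-const (x ∷ xs) k = trans (cong (_+_ k) (∑-const xs k)) (sym (ℤ.suc-* (+ length xs) k))

∑-swap : (xs : List A) (ys : List B) (F : A → B → ℤ) →
         ∑[ x ∈ xs ] ∑[ y ∈ ys ] F x y ≡ ∑[ y ∈ ys ] ∑[ x ∈ xs ] F x y
∑-swap []       ys F = sym (∑-zero ys (λ _ → refl))
∑-swap (x ∷ xs) ys F =
  trans (cong (_+_ (∑ ys (F x))) (∑-swap xs ys F)) (sym (∑-distrib-+ ys (F x) _))

∑-++ : (xs ys : List A) (F : A → ℤ) → ∑ (xs ++ ys) F ≡ ∑ xs F + ∑ ys F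
∑-++ []       ys F = sym (ℤ.+-identityˡ _)
∑-++ (x ∷ xs) ys F = trans (cong (_+_ (F x)) (∑-++ xs ys F)) (sym (ℤ.+-assoc (F x) _ _))

∑-map : (g : A → B) (xs : List A) (F : B → ℤ) → ∑ (map g xs) F ≡ ∑[ x ∈ xs ] F (g x)
∑-map g []       F = refl
∑-map g (x ∷ xs) F = cong (_+_ (F (g x))) (∑-map g xs F)

∑-product : (xs : List A) (ys : List B) (F : A → ℤ) (G : B → ℤ) →
            ∑ xs F * ∑ ys G ≡ ∑[ x ∈ xs ] ∑[ y ∈ ys ] F x * G y
∑-product xs ys F G = trans (sym (∑-distribʳ-* xs (∑ ys G) F))
  (∑-cong xs (λ x → sym (∑-distribˡ-* ys (F x) G)))

∑≢0⇒∃ : (xs : List A) → ∑ xs F ≢ 0ℤ → ∃[ x ] (x ∈ xs × F x ≢ 0ℤ)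
∑≢0⇒∃ []       ∑≢0 = contradiction refl ∑≢0
∑≢0⇒∃ {F = F} (x ∷ xs) ∑≢0 with F x ℤ.≟ 0ℤ
... | no Fx≢0 = x , here refl , Fx≢0
... | yes Fx≡0 with y , y∈xs , Fy≢0 ← ∑≢0⇒∃ xs (λ ∑≡0 → ∑≢0 (cong₂ _+_ Fx≡0 ∑≡0)) =
  y , there y∈xs , Fy≢0

-- Induction on `xs`: the head is cut out of `ys` at one occurrence, and uniqueness keeps the other
-- entries of `xs` inside what remains of `ys`.
∑-⊆ : (xs ys : List A) → (∀ x → 0ℤ ≤ F x) → Unique xs → (∀ {x} → x ∈ xs → x ∈ ys) →
      ∑ xs F ≤ ∑ ys F
∑-⊆ []       ys F≥0 _ _ = ∑-nonneg ys F≥0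
∑-⊆ {F = F} (x ∷ xs) ys F≥0 (x∉xs ∷ xs!) xs⊆ys
  with as , bs , refl ← ∈-∃++ (xs⊆ys (here refl)) = begin
    F x + ∑ xs F                ≤⟨ ℤ.+-monoʳ-≤ (F x) (∑-⊆ xs (as ++ bs) F≥0 xs! xs⊆as++bs) ⟩
    F x + ∑ (as ++ bs) F        ≡⟨ cong (_+_ (F x)) (∑-++ as bs F) ⟩
    F x + (∑ as F + ∑ bs F)     ≡⟨ comm₃ (F x) (∑ as F) (∑ bs F) ⟩
    ∑ as F + (F x + ∑ bs F)     ≡⟨ ∑-++ as (x ∷ bs) F ⟨
    ∑ (as ++ x ∷ bs) F          ∎
  where
  open ℤ.≤-Reasoning
  comm₃ : ∀ a b c → a + (b + c) ≡ b + (a + c)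
  comm₃ = solve-∀
  xs⊆as++bs : ∀ {y} → y ∈ xs → y ∈ as ++ bs
  xs⊆as++bs y∈xs with ∈-++⁻ as (xs⊆ys (there y∈xs))
  ... | inj₁ y∈as         = ∈-++⁺ˡ y∈as
  ... | inj₂ (here refl)  = contradiction refl (All.lookup x∉xs y∈xs)
  ... | inj₂ (there y∈bs) = ∈-++⁺ʳ as y∈bs

-- Squares and the Cauchy-Schwarz inequality.

square-nonneg : ∀ i → 0ℤ ≤ i * i
square-nonneg (+ n)       = subst (0ℤ ≤_) (ℤ.pos-* n n) (+≤+ z≤n)
square-nonneg ℤ.-[1+ n ] = +≤+ z≤n

-- 0 ≤ ∑ (N F x − S)² = N (N ∑ F² − S²), where N = length xs and S = ∑ F.
cauchy-schwarz : (xs : List A) (F : A → ℤ) →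
                 ∑ xs F * ∑ xs F ≤ + length xs * (∑[ x ∈ xs ] F x * F x)
cauchy-schwarz []          F = ℤ.≤-refl
cauchy-schwarz xs@(_ ∷ ys) F =
  ℤ.*-cancelˡ-≤-pos (S * S) (N * Q) N (ℤ.0≤i-j⇒j≤i (subst (0ℤ ≤_) expand
    (∑-nonneg xs (λ x → square-nonneg (N * F x - S)))))
  where
  N = + length xs
  S = ∑ xs F
  Q = ∑[ x ∈ xs ] F x * F x
  term : ∀ n s a → (n * a - s) * (n * a - s) ≡ n * n * (a * a) + - (n * s + n * s) * a + s * s
  term = solve-∀
  total : ∀ n s q → n * n * q + - (n * s + n * s) * s + n * (s * s) ≡ n * (n * q) - n * (s * s)
  total = solve-∀
  open ≡-Reasoning
  expand : ∑[ x ∈ xs ] (N * F x - S) * (N * F x - S) ≡ N * (N * Q) - N * (S * S)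
  expand = begin
    ∑[ x ∈ xs ] (N * F x - S) * (N * F x - S)
      ≡⟨ ∑-cong xs (λ x → term N S (F x)) ⟩
    ∑[ x ∈ xs ] (N * N * (F x * F x) + - (N * S + N * S) * F x + S * S)
      ≡⟨ ∑-distrib-+ xs (λ x → N * N * (F x * F x) + - (N * S + N * S) * F x) (λ _ → S * S) ⟩
    (∑[ x ∈ xs ] N * N * (F x * F x) + - (N * S + N * S) * F x) + (∑[ _ ∈ xs ] S * S)
      ≡⟨ cong₂ _+_ (∑-distrib-+ xs (λ x → N * N * (F x * F x)) (λ x → - (N * S + N * S) * F x)) (∑-const xs (S * S)) ⟩
    (∑[ x ∈ xs ] N * N * (F x * F x)) + (∑[ x ∈ xs ] - (N * S + N * S) * F x) + N * (S * S)
      ≡⟨ cong (_+ N * (S * S)) (cong₂ _+_ (∑-distribˡ-* xs (N * N) (λ x → F x * F x)) (∑-distribˡ-* xs (- (N * S + N * S)) F)) ⟩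
    N * N * Q + - (N * S + N * S) * S + N * (S * S)
      ≡⟨ total N S Q ⟩
    N * (N * Q) - N * (S * S) ∎

-- Sums over initial segments of ℕ.

∑-upTo-last : ∀ n (F : ℕ → ℤ) → ∑ (upTo (suc n)) F ≡ ∑ (upTo n) F + F n
∑-upTo-last n F = begin
  ∑ (upTo (suc n)) F             ≡⟨ cong (λ xs → ∑ xs F) (upTo-∷ʳ n) ⟨
  ∑ (upTo n ++ n ∷ []) F         ≡⟨ ∑-++ (upTo n) (n ∷ []) F ⟩
  ∑ (upTo n) F + (F n + 0ℤ)      ≡⟨ cong (_+_ (∑ (upTo n) F)) (ℤ.+-identityʳ (F n)) ⟩
  ∑ (upTo n) F + F n             ∎
  where open ≡-Reasoning

∑-upTo-first : ∀ n (F : ℕ → ℤ) → ∑ (upTo (suc n)) F ≡ F 0 + (∑[ i ∈ upTo n ] F (suc i))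
∑-upTo-first n F = cong (_+_ (F 0))
  (trans (cong (λ xs → ∑ xs F) (sym (map-upTo suc n))) (∑-map suc (upTo n) F))

∑-upTo-+ : ∀ m n (F : ℕ → ℤ) →
           ∑ (upTo (m ℕ.+ n)) F ≡ ∑ (upTo m) F + (∑[ i ∈ upTo n ] F (m ℕ.+ i))
∑-upTo-+ zero    n F = sym (ℤ.+-identityˡ _)
∑-upTo-+ (suc m) n F = begin
  ∑ (upTo (suc m ℕ.+ n)) F                                     ≡⟨ ∑-upTo-first (m ℕ.+ n) F ⟩
  F 0 + (∑[ i ∈ upTo (m ℕ.+ n) ] F (suc i))                    ≡⟨ cong (_+_ (F 0)) (∑-upTo-+ m n (λ i → F (suc i))) ⟩
  F 0 + (∑ (upTo m) (λ i → F (suc i)) + rest)                  ≡⟨ ℤ.+-assoc (F 0) _ rest ⟨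
  F 0 + ∑ (upTo m) (λ i → F (suc i)) + rest                    ≡⟨ cong (_+ rest) (∑-upTo-first m F) ⟨
  ∑ (upTo (suc m)) F + rest                                    ∎
  where
  open ≡-Reasoning
  rest = ∑[ i ∈ upTo n ] F (suc (m ℕ.+ i))

∑-upTo-const : ∀ n k → ∑[ _ ∈ upTo n ] k ≡ + n * k
∑-upTo-const n k = trans (∑-const (upTo n) k) (cong (λ l → + l * k) (length-upTo n))

-- Indicators and divisibility in ℤ.

indicator : {P : Set} → Dec P → ℤ
indicator P? = if does P? then 1ℤ else 0ℤ

indicator-yes : {P : Set} (P? : Dec P) → P → indicator P? ≡ 1ℤ
indicator-yes (yes _) p = refl
indicator-yes (no ¬p) p = contradiction p ¬p

indicator-no : {P : Set} (P? : Dec P) → ¬ P → indicator P? ≡ 0ℤ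
indicator-no (yes p) ¬p = contradiction p ¬p
indicator-no (no _)  ¬p = refl

⟦_∣_⟧ : ℤ → ℤ → ℤ
⟦ k ∣ u ⟧ = indicator (k ∣? u)

⟦∣⟧-yes : ∀ {k u} → k ∣ u → ⟦ k ∣ u ⟧ ≡ 1ℤ
⟦∣⟧-yes {k} {u} = indicator-yes (k ∣? u)

⟦∣⟧-no : ∀ {k u} → ¬ k ∣ u → ⟦ k ∣ u ⟧ ≡ 0ℤ
⟦∣⟧-no {k} {u} = indicator-no (k ∣? u)

-- An eliminator with explicit motive `Q`: a goal that mentions the indicator is split without
-- abstracting over `k ∣? u`.
⟦∣⟧-cases : ∀ k u (Q : ℤ → Set) → (k ∣ u → Q 1ℤ) → (¬ k ∣ u → Q 0ℤ) → Q ⟦ k ∣ u ⟧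
⟦∣⟧-cases k u Q = by-cases (k ∣? u)
  where
  by-cases : ∀ {P} (P? : Dec P) → (P → Q 1ℤ) → (¬ P → Q 0ℤ) → Q (indicator P?)
  by-cases (yes p) q₁ q₀ = q₁ p
  by-cases (no ¬p) q₁ q₀ = q₀ ¬p

⟦∣⟧-⇔ : ∀ {k u l v} → (k ∣ u → l ∣ v) → (l ∣ v → k ∣ u) → ⟦ k ∣ u ⟧ ≡ ⟦ l ∣ v ⟧
⟦∣⟧-⇔ {k} {u} {l} {v} to from = ⟦∣⟧-cases k u (_≡ ⟦ l ∣ v ⟧)
  (λ k∣u → sym (⟦∣⟧-yes (to k∣u))) (λ k∤u → sym (⟦∣⟧-no (λ l∣v → k∤u (from l∣v))))

⟦∣⟧*-cong : ∀ {k u x y} → (k ∣ u → x ≡ y) → ⟦ k ∣ u ⟧ * x ≡ ⟦ k ∣ u ⟧ * y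
⟦∣⟧*-cong {k} {u} {x} {y} x≡y = ⟦∣⟧-cases k u (λ i → i * x ≡ i * y)
  (λ k∣u → cong (1ℤ *_) (x≡y k∣u)) (λ _ → trans (ℤ.*-zeroˡ x) (sym (ℤ.*-zeroˡ y)))

+∣+⇒∣ : ∀ {m n} → + m ∣ + n → m ℕ.∣ n
+∣+⇒∣ = ∣⇒∣ᵤ

∣⇒+∣+ : ∀ {m n} → m ℕ.∣ n → + m ∣ + n
∣⇒+∣+ = ∣ᵤ⇒∣

∣-difference-sym : ∀ {k} u v → k ∣ u - v → k ∣ v - u
∣-difference-sym u v k∣u-v = subst (_ ∣_) (flip-difference u v) (∣m⇒∣-m k∣u-v)
  where
  flip-difference : ∀ u v → - (u - v) ≡ v - u
  flip-difference = solve-∀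

∣-resp-difference : ∀ {k} u v → k ∣ u - v → k ∣ v → k ∣ u
∣-resp-difference u v k∣u-v k∣v = subst (_ ∣_) (cancel u v) (∣m∣n⇒∣m+n k∣u-v k∣v)
  where
  cancel : ∀ u v → u - v + v ≡ u
  cancel = solve-∀

∣-increment : ∀ {k n} w → k ∣ n → k ∣ w + n - w
∣-increment {k} {n} w = subst (k ∣_) (add-subtract w n)
  where
  add-subtract : ∀ w n → n ≡ w + n - w
  add-subtract = solve-∀

-- Periodic functions on ℤ and their sums over full periods.

Period : (ℤ → ℤ) → ℤ → Set
Period h s = ∀ w → h (w + s) ≡ h w

module _ {h : ℤ → ℤ} where

  period-+ : ∀ {s t} → Period h s → Period h t → Period h (s + t)
  period-+ {s} {t} ps pt w = trans (cong h (sym (ℤ.+-assoc w s t))) (trans (pt (w + s)) (ps w))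

  period-neg : ∀ {s} → Period h s → Period h (- s)
  period-neg {s} ps w = trans (sym (ps (w - s))) (cong h (cancel w s))
    where
    cancel : ∀ w s → w - s + s ≡ w
    cancel = solve-∀

  period-ℕ* : ∀ n {s} → Period h s → Period h (+ n * s)
  period-ℕ* zero    {s} ps w = cong h (trans (cong (_+_ w) (ℤ.*-zeroˡ s)) (ℤ.+-identityʳ w))
  period-ℕ* (suc n) {s} ps = subst (Period h) (sym (ℤ.suc-* (+ n) s)) (period-+ ps (period-ℕ* n ps))

  period-* : ∀ k {s} → Period h s → Period h (k * s)
  period-* (+ n)        ps = period-ℕ* n ps
  period-* ℤ.-[1+ n ] {s} ps =
    subst (Period h) (ℤ.neg-distribˡ-* (+ suc n) s) (period-neg (period-ℕ* (suc n) ps))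

  period-∣ : ∀ {s t} → s ∣ t → Period h s → Period h t
  period-∣ (divides k refl) = period-* k

  period-difference : ∀ {s} u v → s ∣ u - v → Period h s → h u ≡ h v
  period-difference u v s∣u-v ps = trans (cong h (split u v)) (period-∣ s∣u-v ps v)
    where
    split : ∀ u v → u ≡ v + (u - v)
    split = solve-∀

  -- The periods of `h` form a subgroup of ℤ, so they contain the Bézout combination of `z` and `e`.
  period-gcd : ∀ z e → Period h z → Period h (+ e) → Period h (+ gcd ∣ z ∣ e)
  period-gcd z e pz pe = go (Bézout.identity (gcd-GCD ∣ z ∣ e))
    where
    g = gcd ∣ z ∣ e
    p∣z∣ : Period h (+ ∣ z ∣)
    p∣z∣ = period-∣ m∣∣m∣ pz
    solveFor : ∀ a {b c} → a + b ≡ c → c + - b ≡ a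
    solveFor a {b} refl = cancel a b
      where
      cancel : ∀ a b → a + b + - b ≡ a
      cancel = solve-∀
    -- Bézout's identity in ℕ carries the subtracted product on the other side; this turns it back
    -- into an integer combination.
    lift : ∀ y n x m → g ℕ.+ y ℕ.* n ≡ x ℕ.* m → + x * + m + - (+ y * + n) ≡ + g
    lift y n x m eq = solveFor (+ g) (trans (cong (_+_ (+ g)) (sym (ℤ.pos-* y n)))
                                            (trans (cong +_ eq) (ℤ.pos-* x m)))
    go : Bézout.Identity g ∣ z ∣ e → Period h (+ g)
    go (Bézout.+- x y eq) = subst (Period h) (lift y e x ∣ z ∣ eq)
      (period-+ (period-* (+ x) p∣z∣) (period-neg (period-* (+ y) pe)))
    go (Bézout.-+ x y eq) = subst (Period h) (lift x ∣ z ∣ y e eq)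
      (period-+ (period-* (+ y) pe) (period-neg (period-* (+ x) p∣z∣)))

-- A sum of `n + 1` consecutive values, split at its first or at its last term, shows that a shift
-- by 1 changes nothing. Thus the shifted sum has period 1 as a function of the shift.
∑-shift : ∀ {h} n → Period h (+ n) → ∀ s → ∑[ i ∈ upTo n ] h (+ i + s) ≡ ∑[ i ∈ upTo n ] h (+ i)
∑-shift {h} n pn s = begin
  H s                 ≡⟨ cong H (trans (sym (ℤ.*-identityʳ s)) (sym (ℤ.+-identityˡ _))) ⟩
  H (0ℤ + s * 1ℤ)     ≡⟨ H-period 0ℤ ⟩
  H 0ℤ                ≡⟨ ∑-cong (upTo n) (λ i → cong h (ℤ.+-identityʳ (+ i))) ⟩
  ∑[ i ∈ upTo n ] h (+ i) ∎
  where
  open ≡-Reasoning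
  H : ℤ → ℤ
  H s = ∑[ i ∈ upTo n ] h (+ i + s)
  H-suc : ∀ s → H (s + 1ℤ) ≡ H s
  H-suc s = +-cancelˡ (h (+ 0 + s)) _ _ (begin
    h (+ 0 + s) + H (s + 1ℤ)
      ≡⟨ cong (_+_ (h (+ 0 + s))) (∑-cong (upTo n) (λ i → cong h (move (+ i) s))) ⟩
    h (+ 0 + s) + (∑[ i ∈ upTo n ] h (+ suc i + s))
      ≡⟨ ∑-upTo-first n (λ i → h (+ i + s)) ⟨
    ∑[ i ∈ upTo (suc n) ] h (+ i + s)
      ≡⟨ ∑-upTo-last n (λ i → h (+ i + s)) ⟩
    H s + h (+ n + s)
      ≡⟨ cong (_+_ (H s)) (trans (cong h (trans (ℤ.+-comm (+ n) s) (cong (_+ + n) (sym (ℤ.+-identityˡ s)))))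
                          (pn (+ 0 + s))) ⟩
    H s + h (+ 0 + s)
      ≡⟨ ℤ.+-comm (H s) _ ⟩
    h (+ 0 + s) + H s ∎)
    where
    move : ∀ i s → i + (s + 1ℤ) ≡ 1ℤ + i + s
    move = solve-∀
  H-period : Period H (s * 1ℤ)
  H-period = period-* {h = H} s H-suc

-- Weighted indicators of the multiples of a modulus.

-- For positive `m` this is the sum of exp(2πi a u / m) over all residues a modulo `m`, in its
-- integer form.
comb : ℕ → ℤ → ℤ
comb m u = + m * ⟦ + m ∣ u ⟧

comb-⇔ : ∀ m u v → (+ m ∣ u → + m ∣ v) → (+ m ∣ v → + m ∣ u) → comb m u ≡ comb m v
comb-⇔ m u v to from = cong (+ m *_) (⟦∣⟧-⇔ to from)

comb-cong : ∀ m u v → + m ∣ u - v → comb m u ≡ comb m v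
comb-cong m u v m∣u-v = comb-⇔ m u v
  (∣-resp-difference v u (∣-difference-sym u v m∣u-v))
  (∣-resp-difference u v m∣u-v)

∑-pick-multiple : ∀ m .{{_ : NonZero m}} (H : ℕ → ℤ) → ∑[ i ∈ upTo m ] comb m (+ i) * H i ≡ + m * H 0
∑-pick-multiple m@(suc k) H = begin
  ∑[ i ∈ upTo m ] comb m (+ i) * H i
    ≡⟨ ∑-upTo-first k (λ i → comb m (+ i) * H i) ⟩
  comb m 0ℤ * H 0 + (∑[ i ∈ upTo k ] comb m (+ suc i) * H (suc i))
    ≡⟨ cong₂ _+_ (cong (_* H 0) (trans (cong (+ m *_) (⟦∣⟧-yes {+ m} {0ℤ} (∣ᵤ⇒∣ (m ℕ.∣0)))) (ℤ.*-identityʳ (+ m))))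
                 (∑-zero (upTo k) rest) ⟩
  + m * H 0 + 0ℤ
    ≡⟨ ℤ.+-identityʳ _ ⟩
  + m * H 0 ∎
  where
  open ≡-Reasoning
  rest : ∀ {i} → i ∈ upTo k → comb m (+ suc i) * H (suc i) ≡ 0ℤ
  rest {i} i∈ = trans (cong (_* H (suc i)) (trans (cong (+ m *_) (⟦∣⟧-no {+ m} {+ suc i}
      (λ m∣i → ℕ.>⇒∤ (s≤s (∈-upTo⁻ i∈)) (+∣+⇒∣ m∣i)))) (ℤ.*-zeroʳ (+ m))))
    (ℤ.*-zeroˡ (H (suc i)))

∑-repeat : ∀ {h} k n → Period h (+ n) →
           ∑[ i ∈ upTo (k ℕ.* n) ] h (+ i) ≡ + k * (∑[ i ∈ upTo n ] h (+ i))
∑-repeat {h} zero    n pn = sym (ℤ.*-zeroˡ (∑[ i ∈ upTo n ] h (+ i)))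
∑-repeat {h} (suc k) n pn = begin
  ∑[ i ∈ upTo (n ℕ.+ k ℕ.* n) ] h (+ i)
    ≡⟨ ∑-upTo-+ n (k ℕ.* n) (λ i → h (+ i)) ⟩
  block + (∑[ i ∈ upTo (k ℕ.* n) ] h (+ (n ℕ.+ i)))
    ≡⟨ cong (_+_ block) (∑-cong (upTo (k ℕ.* n)) (λ i →
         trans (cong h (ℤ.+-comm (+ n) (+ i))) (pn (+ i)))) ⟩
  block + (∑[ i ∈ upTo (k ℕ.* n) ] h (+ i))
    ≡⟨ cong (_+_ block) (∑-repeat k n pn) ⟩
  block + + k * block
    ≡⟨ ℤ.suc-* (+ k) block ⟨
  + suc k * block ∎
  where
  open ≡-Reasoning
  block = ∑[ i ∈ upTo n ] h (+ i)

period-comb : ∀ m n → m ℕ.∣ n → Period (comb m) (+ n)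
period-comb m n m∣n w = comb-cong m (w + + n) w (∣-increment w (∣⇒+∣+ m∣n))

∑-comb : ∀ q g .{{_ : NonZero g}} → g ℕ.∣ q → ∑[ w ∈ upTo q ] comb g (+ w) ≡ + q
∑-comb q g (ℕ.divides k refl) = begin
  ∑[ w ∈ upTo (k ℕ.* g) ] comb g (+ w)    ≡⟨ ∑-repeat k g (period-comb g g ℕ.∣-refl) ⟩
  + k * (∑[ w ∈ upTo g ] comb g (+ w))     ≡⟨ cong (+ k *_) (∑-cong (upTo g) (λ w → sym (ℤ.*-identityʳ _))) ⟩
  + k * (∑[ w ∈ upTo g ] comb g (+ w) * 1ℤ) ≡⟨ cong (+ k *_) (trans (∑-pick-multiple g (λ _ → 1ℤ)) (ℤ.*-identityʳ (+ g))) ⟩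
  + k * + g                              ≡⟨ ℤ.pos-* k g ⟨
  + (k ℕ.* g)                            ∎
  where open ≡-Reasoning

-- The sum is a function h of w with periods z and e, hence with period g = gcd(z, e), and it
-- vanishes unless g ∣ w.  So h = [g ∣ w] h(0), and h(0) is found by summing over w.
∑-comb-linear : ∀ q e .{{_ : NonZero q}} .{{_ : NonZero e}} → e ℕ.∣ q → ∀ z w →
             ∑[ a ∈ upTo q ] comb e (w - + a * z) ≡ + q * comb (gcd ∣ z ∣ e) w
∑-comb-linear q e e∣q z w = begin
  h w                          ≡⟨ h-support w ⟩
  ⟦ + g ∣ w ⟧ * h 0ℤ           ≡⟨ cong (⟦ + g ∣ w ⟧ *_) h0 ⟩
  ⟦ + g ∣ w ⟧ * (+ q * + g)    ≡⟨ assemble ⟦ + g ∣ w ⟧ (+ q) (+ g) ⟩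
  + q * comb g w                  ∎
  where
  open ≡-Reasoning
  g = gcd ∣ z ∣ e
  instance
    g≢0 : NonZero g
    g≢0 = ℕ.≢-nonZero (gcd[m,n]≢0 ∣ z ∣ e (inj₂ (ℕ.≢-nonZero⁻¹ e)))
  g∣z : + g ∣ z
  g∣z = ∣-trans (∣⇒+∣+ (gcd[m,n]∣m ∣ z ∣ e)) ∣m∣∣m
  g∣e : + g ∣ + e
  g∣e = ∣⇒+∣+ (gcd[m,n]∣n ∣ z ∣ e)
  h : ℤ → ℤ
  h w = ∑[ a ∈ upTo q ] comb e (w - + a * z)
  assemble : ∀ i q g → i * (q * g) ≡ q * (g * i)
  assemble = solve-∀

  h-period-z : Period h z
  -- Adding `z` to `w` lowers `a` by 1, and the summand has period `q` in `a` because `e` divides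
  -- `q`.
  h-period-z w = trans (∑-cong (upTo q) (λ a → cong (comb e) (move w z (+ a))))
    (∑-shift {λ a → comb e (w - a * z)} q period-q (- 1ℤ))
    where
    move : ∀ w z a → w + z - a * z ≡ w - (a + - 1ℤ) * z
    move = solve-∀
    difference : ∀ w z a q → - z * q ≡ w - (a + q) * z - (w - a * z)
    difference = solve-∀
    period-q : Period (λ a → comb e (w - a * z)) (+ q)
    period-q a = comb-cong e (w - (a + + q) * z) (w - a * z)
      (subst (+ e ∣_) (difference w z a (+ q)) (∣n⇒∣m*n (- z) (∣⇒+∣+ e∣q)))

  h-period-e : Period h (+ e)
  h-period-e w = ∑-cong (upTo q) (λ a → comb-cong e (w + + e - + a * z) (w - + a * z)
    (subst (+ e ∣_) (difference w (+ e) (+ a * z)) ∣-refl))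
    where
    difference : ∀ w e x → e ≡ w + e - x - (w - x)
    difference = solve-∀

  h-period : Period h (+ g)
  h-period = period-gcd z e h-period-z h-period-e

  h-support : ∀ w → h w ≡ ⟦ + g ∣ w ⟧ * h 0ℤ
  h-support w = ⟦∣⟧-cases (+ g) w (λ i → h w ≡ i * h 0ℤ)
    (λ g∣w → trans (period-difference w 0ℤ (subst (+ g ∣_) (sym (ℤ.+-identityʳ w)) g∣w) h-period)
                   (sym (ℤ.*-identityˡ (h 0ℤ))))
    (λ g∤w → trans (∑-zero (upTo q) (λ {a} _ → trans (cong (+ e *_) (⟦∣⟧-no (λ e∣ →
                     g∤w (∣-resp-difference w (+ a * z) (∣-trans g∣e e∣) (∣n⇒∣m*n (+ a) g∣z)))))
                     (ℤ.*-zeroʳ (+ e))))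
                   (sym (ℤ.*-zeroˡ (h 0ℤ))))

  -- The sum of `h` over a full period is evaluated twice: with `w` innermost every `a` contributes
  -- `q`, while `total₂` goes through the support of `h`. Comparison yields `h 0ℤ`.
  total₁ : ∑[ w ∈ upTo q ] h (+ w) ≡ + q * + q
  total₁ = begin
    ∑[ w ∈ upTo q ] h (+ w)
      ≡⟨ ∑-swap (upTo q) (upTo q) (λ w a → comb e (+ w - + a * z)) ⟩
    ∑[ a ∈ upTo q ] ∑[ w ∈ upTo q ] comb e (+ w - + a * z)
      ≡⟨ ∑-cong (upTo q) (λ a → trans (∑-shift {comb e} q (period-comb e q e∣q) (- (+ a * z))) (∑-comb q e e∣q)) ⟩
    ∑[ a ∈ upTo q ] + q
      ≡⟨ ∑-upTo-const q (+ q) ⟩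
    + q * + q ∎

  total₂ : + g * (∑[ w ∈ upTo q ] h (+ w)) ≡ + q * h 0ℤ
  total₂ = begin
    + g * (∑[ w ∈ upTo q ] h (+ w))
      ≡⟨ ∑-distribˡ-* (upTo q) (+ g) (λ w → h (+ w)) ⟨
    ∑[ w ∈ upTo q ] + g * h (+ w)
      ≡⟨ ∑-cong (upTo q) (λ w → trans (cong (+ g *_) (h-support (+ w))) (sym (ℤ.*-assoc (+ g) _ _))) ⟩
    ∑[ w ∈ upTo q ] comb g (+ w) * h 0ℤ
      ≡⟨ ∑-distribʳ-* (upTo q) (h 0ℤ) (λ w → comb g (+ w)) ⟩
    (∑[ w ∈ upTo q ] comb g (+ w)) * h 0ℤ
      ≡⟨ cong (_* h 0ℤ) (∑-comb q g (ℕ.∣-trans (gcd[m,n]∣n ∣ z ∣ e) e∣q)) ⟩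
    + q * h 0ℤ ∎

  h0 : h 0ℤ ≡ + q * + g
  h0 = ℤ.*-cancelˡ-≡ (+ q) (h 0ℤ) (+ q * + g) (begin
    + q * h 0ℤ          ≡⟨ total₂ ⟨
    + g * _             ≡⟨ cong (+ g *_) total₁ ⟩
    + g * (+ q * + q)   ≡⟨ rotate (+ g) (+ q) ⟩
    + q * (+ q * + g)   ∎)
    where
    rotate : ∀ g q → g * (q * q) ≡ q * (q * g)
    rotate = solve-∀

-- Divisor sums and Möbius inversion.

-- The condition on the divisor sits in an indicator and not in the index list, so that divisor sums
-- interchange with other sums by linearity alone.
∑∣ : ℕ → (ℕ → ℤ) → ℤ
∑∣ m A = ∑[ i ∈ upTo m ] ⟦ + suc i ∣ + m ⟧ * A (suc i)

∑∣-proper : ℕ → (ℕ → ℤ) → ℤ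
∑∣-proper m A = ∑[ i ∈ upTo (pred m) ] ⟦ + suc i ∣ + m ⟧ * A (suc i)

∑∣-split : ∀ m .{{_ : NonZero m}} A → ∑∣ m A ≡ ∑∣-proper m A + A m
∑∣-split m@(suc k) A = trans (∑-upTo-last k _) (cong (_+_ (∑∣-proper m A))
  (trans (cong (_* A m) (⟦∣⟧-yes {+ m} {+ m} ∣-refl)) (ℤ.*-identityˡ (A m))))

∑∣-proper-cong : ∀ m .{{_ : NonZero m}} {A B} →
  (∀ e .{{_ : NonZero e}} → e < m → e ℕ.∣ m → A e ≡ B e) → ∑∣-proper m A ≡ ∑∣-proper m B
∑∣-proper-cong m@(suc k) A≡B = ∑-cong-∈ (upTo k) (λ {i} i∈ →
  ⟦∣⟧*-cong (λ i∣m → A≡B (suc i) (s≤s (∈-upTo⁻ i∈)) (+∣+⇒∣ i∣m)))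

-- Strong induction on `m`: the proper divisors contribute equally to both sums and cancel.
-- Restricting to divisors of `z` allows hypotheses that hold only there, such as a congruence
-- modulo `z`.
möbius-unique : ∀ (A B : ℕ → ℤ) z →
  (∀ m .{{_ : NonZero m}} → + m ∣ z → ∑∣ m A ≡ ∑∣ m B) →
  ∀ m .{{_ : NonZero m}} → + m ∣ z → A m ≡ B m
möbius-unique A B z ∑A≡∑B m = <-rec (λ m → .{{NonZero m}} → + m ∣ z → A m ≡ B m) step m
  where
  step : ∀ m → (∀ {e} → e < m → .{{NonZero e}} → + e ∣ z → A e ≡ B e) →
         .{{NonZero m}} → + m ∣ z → A m ≡ B m
  step m rec m∣z = +-cancelˡ (∑∣-proper m A) (A m) (B m) (begin
    ∑∣-proper m A + A m   ≡⟨ ∑∣-split m A ⟨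
    ∑∣ m A                ≡⟨ ∑A≡∑B m m∣z ⟩
    ∑∣ m B                ≡⟨ ∑∣-split m B ⟩
    ∑∣-proper m B + B m   ≡⟨ cong (_+ B m) (∑∣-proper-cong m (λ e e<m e∣m →
                               rec e<m (∣-trans (∣⇒+∣+ e∣m) m∣z))) ⟨
    ∑∣-proper m A + B m   ∎)
    where open ≡-Reasoning

-- The divisors of the gcd are the common divisors. The range is first padded up to `m` by terms
-- that vanish, since no number above the gcd divides it.
∑∣-gcd : ∀ m .{{_ : NonZero m}} z A → ∑∣ (gcd ∣ z ∣ m) A ≡ ∑∣ m (λ e → ⟦ + e ∣ z ⟧ * A e)
∑∣-gcd m z A = begin
  ∑∣ g A
    ≡⟨ ℤ.+-identityʳ (∑∣ g A) ⟨
  ∑∣ g A + 0ℤ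
    ≡⟨ cong (_+_ (∑∣ g A)) (∑-zero (upTo (m ℕ.∸ g)) (λ {i} _ → trans
         (cong (_* A (suc (g ℕ.+ i))) (⟦∣⟧-no (λ i∣g → ℕ.>⇒∤ (s≤s (ℕ.m≤m+n g i)) (+∣+⇒∣ i∣g))))
         (ℤ.*-zeroˡ (A (suc (g ℕ.+ i)))))) ⟨
  ∑∣ g A + (∑[ i ∈ upTo (m ℕ.∸ g) ] ⟦ + suc (g ℕ.+ i) ∣ + g ⟧ * A (suc (g ℕ.+ i)))
    ≡⟨ ∑-upTo-+ g (m ℕ.∸ g) (λ i → ⟦ + suc i ∣ + g ⟧ * A (suc i)) ⟨
  ∑[ i ∈ upTo (g ℕ.+ (m ℕ.∸ g)) ] ⟦ + suc i ∣ + g ⟧ * A (suc i)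
    ≡⟨ cong (λ n → ∑[ i ∈ upTo n ] ⟦ + suc i ∣ + g ⟧ * A (suc i)) (ℕ.m+[n∸m]≡n (ℕ.∣⇒≤ g∣m)) ⟩
  ∑[ i ∈ upTo m ] ⟦ + suc i ∣ + g ⟧ * A (suc i)
    ≡⟨ ∑-cong (upTo m) (λ i → trans (cong (_* A (suc i)) (divides-both (suc i))) (ℤ.*-assoc ⟦ + suc i ∣ + m ⟧ ⟦ + suc i ∣ z ⟧ (A (suc i)))) ⟩
  ∑∣ m (λ e → ⟦ + e ∣ z ⟧ * A e) ∎
  where
  open ≡-Reasoning
  g = gcd ∣ z ∣ m
  instance
    g≢0 : NonZero g
    g≢0 = ℕ.≢-nonZero (gcd[m,n]≢0 ∣ z ∣ m (inj₂ (ℕ.≢-nonZero⁻¹ m)))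
  g∣m : g ℕ.∣ m
  g∣m = gcd[m,n]∣n ∣ z ∣ m
  divides-both : ∀ e → ⟦ + e ∣ + g ⟧ ≡ ⟦ + e ∣ + m ⟧ * ⟦ + e ∣ z ⟧
  divides-both e = ⟦∣⟧-cases (+ e) (+ m) (λ i → ⟦ + e ∣ + g ⟧ ≡ i * ⟦ + e ∣ z ⟧)
    (λ e∣m → trans (⟦∣⟧-⇔ {+ e} {+ g} {+ e} {z}
       (λ e∣g → ∣ᵤ⇒∣ (ℕ.∣-trans (+∣+⇒∣ e∣g) (gcd[m,n]∣m ∣ z ∣ m)))
       (λ e∣z → ∣⇒+∣+ (gcd-greatest (∣⇒∣ᵤ e∣z) (+∣+⇒∣ e∣m))))
       (sym (ℤ.*-identityˡ ⟦ + e ∣ z ⟧)))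
    (λ e∤m → trans (⟦∣⟧-no (λ e∣g → e∤m (∣-trans e∣g (∣⇒+∣+ g∣m)))) (sym (ℤ.*-zeroˡ ⟦ + e ∣ z ⟧)))

-- Ramanujan sums.

-- c m is the Ramanujan sum of modulus m, i.e. the Möbius inverse of comb; the first argument of
-- c-fuel bounds the depth of the recursion over proper divisors.
c-fuel : ℕ → ℕ → ℤ → ℤ
c-fuel zero    m u = 0ℤ
c-fuel (suc n) m u = comb m u - ∑∣-proper m (λ e → c-fuel n e u)

c : ℕ → ℤ → ℤ
c m = c-fuel (suc m) m

-- The recursion descends to proper divisors, so all fuels above `m` give the same value.
c-fuel-irrelevant : ∀ n n′ m .{{_ : NonZero m}} u → m < n → m < n′ → c-fuel n m u ≡ c-fuel n′ m u
c-fuel-irrelevant (suc n) (suc n′) m u (s≤s m≤n) (s≤s m≤n′) =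
  cong (λ s → comb m u - s) (∑∣-proper-cong m (λ e e<m _ →
    c-fuel-irrelevant n n′ e u (ℕ.<-≤-trans e<m m≤n) (ℕ.<-≤-trans e<m m≤n′)))

c-unfold : ∀ m .{{_ : NonZero m}} u → c m u ≡ comb m u - ∑∣-proper m (λ e → c e u)
c-unfold m u = cong (λ s → comb m u - s) (∑∣-proper-cong m (λ e e<m _ →
  c-fuel-irrelevant m (suc e) e u e<m ℕ.≤-refl))

-- Together with `möbius-unique`, this reduces identities that are linear in `c` to identities for
-- `comb`.
∑∣-c : ∀ m .{{_ : NonZero m}} u → ∑∣ m (λ e → c e u) ≡ comb m u
∑∣-c m u = begin
  ∑∣ m (λ e → c e u)        ≡⟨ ∑∣-split m (λ e → c e u) ⟩
  s + c m u                 ≡⟨ cong (_+_ s) (c-unfold m u) ⟩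
  s + (comb m u - s)           ≡⟨ cancel s (comb m u) ⟩
  comb m u                     ∎
  where
  open ≡-Reasoning
  s = ∑∣-proper m (λ e → c e u)
  cancel : ∀ s x → s + (x - s) ≡ x
  cancel = solve-∀

c-1 : ∀ u → c 1 u ≡ 1ℤ
c-1 u = trans (ℤ.+-identityʳ (comb 1 u)) (trans (ℤ.*-identityˡ ⟦ + 1 ∣ u ⟧) (⟦∣⟧-yes {+ 1} {u} (∣ᵤ⇒∣ (ℕ.1∣ ∣ u ∣))))

-- For every `e` dividing `u - v` the two divisor sums are `comb e u` and `comb e v`, which agree;
-- Möbius uniqueness does the rest.
c-cong : ∀ m .{{_ : NonZero m}} u v → + m ∣ u - v → c m u ≡ c m v
c-cong m u v = möbius-unique (λ e → c e u) (λ e → c e v) (u - v)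
  (λ e e∣u-v → trans (∑∣-c e u) (trans (comb-cong e u v e∣u-v) (sym (∑∣-c e v)))) m

∑∣-∑ : ∀ {A : Set} m (xs : List A) (F : ℕ → A → ℤ) →
       ∑∣ m (λ e → ∑ xs (F e)) ≡ ∑[ x ∈ xs ] ∑∣ m (λ e → F e x)
∑∣-∑ m xs F = trans (∑-cong (upTo m) (λ i → sym (∑-distribˡ-* xs ⟦ + suc i ∣ + m ⟧ (F (suc i)))))
                    (∑-swap (upTo m) xs (λ i x → ⟦ + suc i ∣ + m ⟧ * F (suc i) x))

∑∣-distribˡ-* : ∀ m k A → ∑∣ m (λ e → k * A e) ≡ k * ∑∣ m A
∑∣-distribˡ-* m k A = trans (∑-cong (upTo m) (λ i → rotate ⟦ + suc i ∣ + m ⟧ k (A (suc i))))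
                            (∑-distribˡ-* (upTo m) k _)
  where
  rotate : ∀ i k a → i * (k * a) ≡ k * (i * a)
  rotate = solve-∀

-- The Möbius inverse of `∑-comb-linear`: expanding `comb` at the gcd gives the sum over those
-- divisors of `m` that also divide `z`. Summation along a progression of difference `z` thus kills
-- `c m` unless `m` divides `z`.
∑-c-linear : ∀ q m .{{_ : NonZero q}} .{{_ : NonZero m}} → m ℕ.∣ q → ∀ z w →
             ∑[ a ∈ upTo q ] c m (w - + a * z) ≡ + q * (⟦ + m ∣ z ⟧ * c m w)
∑-c-linear q m m∣q z w = möbius-unique
  (λ e → ∑[ a ∈ upTo q ] c e (w - + a * z)) (λ e → + q * (⟦ + e ∣ z ⟧ * c e w)) (+ q) summed m (∣⇒+∣+ m∣q)
  where
  open ≡-Reasoning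
  summed : ∀ m .{{_ : NonZero m}} → + m ∣ + q →
           ∑∣ m (λ e → ∑[ a ∈ upTo q ] c e (w - + a * z)) ≡ ∑∣ m (λ e → + q * (⟦ + e ∣ z ⟧ * c e w))
  summed m m∣q = begin
    ∑∣ m (λ e → ∑[ a ∈ upTo q ] c e (w - + a * z))
      ≡⟨ ∑∣-∑ m (upTo q) (λ e a → c e (w - + a * z)) ⟩
    ∑[ a ∈ upTo q ] ∑∣ m (λ e → c e (w - + a * z))
      ≡⟨ ∑-cong (upTo q) (λ a → ∑∣-c m (w - + a * z)) ⟩
    ∑[ a ∈ upTo q ] comb m (w - + a * z)
      ≡⟨ ∑-comb-linear q m (+∣+⇒∣ m∣q) z w ⟩
    + q * comb (gcd ∣ z ∣ m) w
      ≡⟨ cong (+ q *_) (∑∣-c (gcd ∣ z ∣ m) {{g≢0}} w) ⟨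
    + q * ∑∣ (gcd ∣ z ∣ m) (λ e → c e w)
      ≡⟨ cong (+ q *_) (∑∣-gcd m z (λ e → c e w)) ⟩
    + q * ∑∣ m (λ e → ⟦ + e ∣ z ⟧ * c e w)
      ≡⟨ ∑∣-distribˡ-* m (+ q) (λ e → ⟦ + e ∣ z ⟧ * c e w) ⟨
    ∑∣ m (λ e → + q * (⟦ + e ∣ z ⟧ * c e w)) ∎
    where
    g≢0 : NonZero (gcd ∣ z ∣ m)
    g≢0 = ℕ.≢-nonZero (gcd[m,n]≢0 ∣ z ∣ m (inj₂ (ℕ.≢-nonZero⁻¹ m)))

period-c : ∀ m n .{{_ : NonZero m}} → m ℕ.∣ n → Period (c m) (+ n)
period-c m n m∣n w = c-cong m (w + + n) w (∣-increment w (∣⇒+∣+ m∣n))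

∑∣-distribʳ-* : ∀ m k A → ∑∣ m (λ e → A e * k) ≡ ∑∣ m A * k
∑∣-distribʳ-* m k A = trans (∑-cong (upTo m) (λ i → sym (ℤ.*-assoc ⟦ + suc i ∣ + m ⟧ (A (suc i)) k)))
                            (∑-distribʳ-* (upTo m) k _)

∑∣-proper-zero : ∀ m .{{_ : NonZero m}} {A} →
  (∀ e .{{_ : NonZero e}} → e < m → e ℕ.∣ m → A e ≡ 0ℤ) → ∑∣-proper m A ≡ 0ℤ
∑∣-proper-zero m A≡0 = trans (∑∣-proper-cong m A≡0)
  (∑-zero (upTo (pred m)) (λ {i} _ → ℤ.*-zeroʳ ⟦ + suc i ∣ + m ⟧))

period-reflect : ∀ {h} n a → Period h (+ n) → Period (λ b → h (a - b)) (+ n)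
period-reflect {h} n a pn b = trans (cong h (move a b (+ n))) (period-neg {h} pn (a - b))
  where
  move : ∀ a b n → a - (b + n) ≡ a - b + - n
  move = solve-∀

-- c e is constant along the progression b + e ℤ, over which c m sums to 0 unless m ∣ e.
∑-c-orthogonal : ∀ m e .{{_ : NonZero m}} .{{_ : NonZero e}} → e < m → e ℕ.∣ m → ∀ α β →
                 ∑[ b ∈ upTo m ] c e (α - + b) * c m (β - + b) ≡ 0ℤ
∑-c-orthogonal m e e<m e∣m α β = ℤ.*-cancelˡ-≡ (+ m) _ 0ℤ (begin
  + m * (∑[ b ∈ upTo m ] h (+ b))
    ≡⟨ ∑-upTo-const m (∑[ b ∈ upTo m ] h (+ b)) ⟨
  ∑[ k ∈ upTo m ] ∑[ b ∈ upTo m ] h (+ b)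
    -- A shift by a multiple of `e` leaves the sum over a full period unchanged, so the `m` copies
    -- may be shifted independently; the inner sum then runs along a progression of difference `e`.
    ≡⟨ ∑-cong (upTo m) (λ k → ∑-shift {h} m h-period (+ k * + e)) ⟨
  ∑[ k ∈ upTo m ] ∑[ b ∈ upTo m ] h (+ b + + k * + e)
    ≡⟨ ∑-swap (upTo m) (upTo m) (λ k b → h (+ b + + k * + e)) ⟩
  ∑[ b ∈ upTo m ] ∑[ k ∈ upTo m ] h (+ b + + k * + e)
    ≡⟨ ∑-zero (upTo m) (λ {b} _ → progression (+ b)) ⟩
  0ℤ
    ≡⟨ ℤ.*-zeroʳ (+ m) ⟨
  + m * 0ℤ ∎)
  where
  open ≡-Reasoning
  h : ℤ → ℤ
  h b = c e (α - b) * c m (β - b)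
  h-period : Period h (+ m)
  h-period b = cong₂ _*_ (period-reflect {c e} m α (period-c e m e∣m) b)
                         (period-reflect {c m} m β (period-c m m ℕ.∣-refl) b)
  difference : ∀ α b k e → - k * e ≡ α - (b + k * e) - (α - b)
  difference = solve-∀
  move : ∀ β b k → β - (b + k) ≡ β - b - k
  move = solve-∀
  progression : ∀ b → ∑[ k ∈ upTo m ] h (b + + k * + e) ≡ 0ℤ
  progression b = begin
    ∑[ k ∈ upTo m ] h (b + + k * + e)
      ≡⟨ ∑-cong (upTo m) (λ k → cong₂ _*_
           (c-cong e (α - (b + + k * + e)) (α - b) (divides (- + k) (sym (difference α b (+ k) (+ e)))))
           (cong (c m) (move β b (+ k * + e)))) ⟩
    ∑[ k ∈ upTo m ] c e (α - b) * c m (β - b - + k * + e)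
      ≡⟨ ∑-distribˡ-* (upTo m) (c e (α - b)) (λ k → c m (β - b - + k * + e)) ⟩
    c e (α - b) * (∑[ k ∈ upTo m ] c m (β - b - + k * + e))
      ≡⟨ cong (c e (α - b) *_) (∑-c-linear m m ℕ.∣-refl (+ e) (β - b)) ⟩
    c e (α - b) * (+ m * (⟦ + m ∣ + e ⟧ * c m (β - b)))
      ≡⟨ cong (λ i → c e (α - b) * (+ m * (i * c m (β - b)))) (⟦∣⟧-no (λ m∣e → ℕ.>⇒∤ e<m (+∣+⇒∣ m∣e))) ⟩
    c e (α - b) * (+ m * (0ℤ * c m (β - b)))
      ≡⟨ vanish (c e (α - b)) (+ m) (c m (β - b)) ⟩
    0ℤ ∎
    where
    vanish : ∀ x m y → x * (m * (0ℤ * y)) ≡ 0ℤ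
    vanish = solve-∀

-- By orthogonality the terms with a proper divisor `e` in place of `m` in the first factor add up
-- to nothing, so they may be included. The first factor then becomes `comb m`, which selects the
-- residue b ≡ α.
∑-c-correlation : ∀ m .{{_ : NonZero m}} α β →
                  ∑[ b ∈ upTo m ] c m (α - + b) * c m (β - + b) ≡ + m * c m (β - α)
∑-c-correlation m α β = begin
  X m
    ≡⟨ ℤ.+-identityˡ (X m) ⟨
  0ℤ + X m
    ≡⟨ cong (_+ X m) (∑∣-proper-zero m (λ e e<m e∣m → ∑-c-orthogonal m e e<m e∣m α β)) ⟨
  ∑∣-proper m X + X m
    ≡⟨ ∑∣-split m X ⟨
  ∑∣ m X
    ≡⟨ ∑∣-∑ m (upTo m) (λ e b → c e (α - + b) * c m (β - + b)) ⟩
  ∑[ b ∈ upTo m ] ∑∣ m (λ e → c e (α - + b) * c m (β - + b))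
    ≡⟨ ∑-cong (upTo m) (λ b → trans (∑∣-distribʳ-* m (c m (β - + b)) (λ e → c e (α - + b)))
         (cong (_* c m (β - + b)) (∑∣-c m (α - + b)))) ⟩
  ∑[ b ∈ upTo m ] h (+ b)
    ≡⟨ ∑-shift {h} m h-period α ⟨
  ∑[ b ∈ upTo m ] h (+ b + α)
    ≡⟨ ∑-cong (upTo m) (λ b → cong₂ _*_ (reflect (+ b)) (cong (c m) (move β (+ b) α))) ⟩
  ∑[ b ∈ upTo m ] comb m (+ b) * c m (β - α - + b)
    ≡⟨ ∑-pick-multiple m (λ b → c m (β - α - + b)) ⟩
  + m * c m (β - α - 0ℤ)
    ≡⟨ cong (λ u → + m * c m u) (ℤ.+-identityʳ (β - α)) ⟩
  + m * c m (β - α) ∎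
  where
  open ≡-Reasoning
  X : ℕ → ℤ
  X e = ∑[ b ∈ upTo m ] c e (α - + b) * c m (β - + b)
  h : ℤ → ℤ
  h b = comb m (α - b) * c m (β - b)
  h-period : Period h (+ m)
  h-period b = cong₂ _*_ (period-reflect {comb m} m α (period-comb m m ℕ.∣-refl) b)
                         (period-reflect {c m} m β (period-c m m ℕ.∣-refl) b)
  move : ∀ β b α → β - (b + α) ≡ β - α - b
  move = solve-∀
  cancel : ∀ α b → α - (b + α) ≡ - b
  cancel = solve-∀
  reflect : ∀ b → comb m (α - (b + α)) ≡ comb m b
  reflect b = trans (cong (comb m) (cancel α b)) (comb-⇔ m (- b) b
    (λ m∣-b → subst (+ m ∣_) (ℤ.neg-involutive b) (∣m⇒∣-m m∣-b)) ∣m⇒∣-m)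

-- The correlation formula at α = β = 0 presents `+ m * c m 0ℤ` as a sum of squares. The value
-- itself is Euler's totient of `m`.
c-0-nonneg : ∀ m .{{_ : NonZero m}} → 0ℤ ≤ c m 0ℤ
c-0-nonneg m@(suc _) = ℤ.*-cancelˡ-≤-pos 0ℤ (c m 0ℤ) (+ m) (subst₂ _≤_ (sym (ℤ.*-zeroʳ (+ m)))
  (∑-c-correlation m 0ℤ 0ℤ) (∑-nonneg (upTo m) (λ b → square-nonneg (c m (0ℤ - + b)))))

-- The nonnegative values `c e 0ℤ` over all divisors of `m` add up to `comb m 0ℤ`, which is `m`.
c-0-≤ : ∀ m .{{_ : NonZero m}} → c m 0ℤ ≤ + m
c-0-≤ m = begin
  c m 0ℤ                                    ≡⟨ c-unfold m 0ℤ ⟩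
  comb m 0ℤ - ∑∣-proper m (λ e → c e 0ℤ)       ≤⟨ ℤ.+-monoʳ-≤ (comb m 0ℤ) (ℤ.neg-mono-≤ (∑-nonneg (upTo (pred m)) term-nonneg)) ⟩
  comb m 0ℤ + 0ℤ                               ≡⟨ ℤ.+-identityʳ (comb m 0ℤ) ⟩
  comb m 0ℤ                                    ≡⟨ cong (+ m *_) (⟦∣⟧-yes {+ m} {0ℤ} (∣ᵤ⇒∣ (m ℕ.∣0))) ⟩
  + m * 1ℤ                                  ≡⟨ ℤ.*-identityʳ (+ m) ⟩
  + m                                       ∎
  where
  open ℤ.≤-Reasoning
  term-nonneg : ∀ i → 0ℤ ≤ ⟦ + suc i ∣ + m ⟧ * c (suc i) 0ℤ
  term-nonneg i = ⟦∣⟧-cases (+ suc i) (+ m) (λ j → 0ℤ ≤ j * c (suc i) 0ℤ)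
    (λ _ → subst (0ℤ ≤_) (sym (ℤ.*-identityˡ (c (suc i) 0ℤ))) (c-0-nonneg (suc i)))
    (λ _ → ℤ.≤-reflexive (sym (ℤ.*-zeroˡ (c (suc i) 0ℤ))))

-- Sums over all vectors modulo q.

∑-tabulate : ∀ n (F : ℕ → ℤ) → ∑ (allFin n) (F ∘ toℕ) ≡ ∑ (upTo n) F
∑-tabulate zero    F = refl
∑-tabulate (suc n) F = begin
  F 0 + ∑ (tabulate Fin.suc) F′                   ≡⟨ cong (λ xs → F 0 + ∑ xs F′) (map-tabulate id Fin.suc) ⟨
  F 0 + ∑ (map Fin.suc (allFin n)) F′             ≡⟨ cong (_+_ (F 0)) (∑-map Fin.suc (allFin n) F′) ⟩
  F 0 + ∑ (allFin n) (F ∘ suc ∘ toℕ)             ≡⟨ cong (_+_ (F 0)) (∑-tabulate n (F ∘ suc)) ⟩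
  F 0 + ∑ (upTo n) (F ∘ suc)                     ≡⟨ ∑-upTo-first n F ⟨
  ∑ (upTo (suc n)) F                             ∎
  where
  open ≡-Reasoning
  F′ : Fin (suc n) → ℤ
  F′ = F ∘ toℕ

∑-cartesianProductWith : (g : A → B → C) (xs : List A) (ys : List B) (F : C → ℤ) →
  ∑ (cartesianProductWith g xs ys) F ≡ ∑[ x ∈ xs ] ∑[ y ∈ ys ] F (g x y)
∑-cartesianProductWith g []       ys F = refl
∑-cartesianProductWith g (x ∷ xs) ys F =
  trans (∑-++ (map (g x) ys) _ F) (cong₂ _+_ (∑-map (g x) ys F) (∑-cartesianProductWith g xs ys F))

∑-rotate : (xs : List A) (ys : List B) (zs : List C) (F : A → B → C → ℤ) →
           ∑[ x ∈ xs ] ∑[ y ∈ ys ] ∑[ z ∈ zs ] F x y z ≡ ∑[ y ∈ ys ] ∑[ z ∈ zs ] ∑[ x ∈ xs ] F x y z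
∑-rotate xs ys zs F = trans (∑-swap xs ys (λ x y → ∑[ z ∈ zs ] F x y z))
                            (∑-cong ys (λ y → ∑-swap xs zs (λ x z → F x y z)))

module _ {q : ℕ} where

  ι : ℤ/ q → ℤ
  ι x = + toℕ x

  vectors : ∀ d → List (Vec (ℤ/ q) d)
  vectors zero    = [] ∷ []
  vectors (suc d) = cartesianProductWith _∷_ (allFin q) (vectors d)

  ∈-vectors : ∀ {d} (v : Vec (ℤ/ q) d) → v ∈ vectors d
  ∈-vectors []      = here refl
  ∈-vectors (x ∷ v) = ∈-cartesianProductWith⁺ _∷_ (∈-allFin x) (∈-vectors v)

  -- `dist` is the squared distance of integer representatives, without reduction. `φ v w` is ‖v‖² -
  -- 2 v · w, which for fixed `v` is affine in `w`.
  dist φ : ∀ {d} → Vec (ℤ/ q) d → Vec (ℤ/ q) d → ℤ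
  dist []      []      = 0ℤ
  dist (x ∷ v) (y ∷ w) = (ι x - ι y) * (ι x - ι y) + dist v w
  φ []      []      = 0ℤ
  φ (x ∷ v) (y ∷ w) = ι x * ι x - ι y * (ι x + ι x) + φ v w

  normSq : ∀ {d} → Vec (ℤ/ q) d → ℤ
  normSq []      = 0ℤ
  normSq (y ∷ w) = ι y * ι y + normSq w

  dist-φ : ∀ {d} (v w : Vec (ℤ/ q) d) → dist v w ≡ φ v w + normSq w
  dist-φ []      []      = refl
  dist-φ (x ∷ v) (y ∷ w) = trans (cong (_+_ ((ι x - ι y) * (ι x - ι y))) (dist-φ v w))
                                 (expand (ι x) (ι y) (φ v w) (normSq w))
    where
    expand : ∀ x y a b → (x - y) * (x - y) + (a + b) ≡ x * x - y * (x + x) + a + (y * y + b)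
    expand = solve-∀

  ⟦_∣_⊖_⟧ : ∀ {d} → ℕ → Vec (ℤ/ q) d → Vec (ℤ/ q) d → ℤ
  ⟦ m ∣ []     ⊖ []     ⟧ = 1ℤ
  ⟦ m ∣ x′ ∷ v′ ⊖ x ∷ v ⟧ = ⟦ + m ∣ ι x′ - ι x ⟧ * ⟦ m ∣ v′ ⊖ v ⟧

  ⟦∣⊖⟧-nonneg : ∀ {d} m (v′ v : Vec (ℤ/ q) d) → 0ℤ ≤ ⟦ m ∣ v′ ⊖ v ⟧
  ⟦∣⊖⟧-nonneg m []        []      = +≤+ z≤n
  ⟦∣⊖⟧-nonneg m (x′ ∷ v′) (x ∷ v) = ⟦∣⟧-cases (+ m) (ι x′ - ι x) (λ i → 0ℤ ≤ i * ⟦ m ∣ v′ ⊖ v ⟧)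
    (λ _ → subst (0ℤ ≤_) (sym (ℤ.*-identityˡ ⟦ m ∣ v′ ⊖ v ⟧)) (⟦∣⊖⟧-nonneg m v′ v))
    (λ _ → ℤ.≤-reflexive (sym (ℤ.*-zeroˡ ⟦ m ∣ v′ ⊖ v ⟧)))

  ∑-vectors : ∀ d (F : Vec (ℤ/ q) (suc d) → ℤ) →
              ∑ (vectors (suc d)) F ≡ ∑[ x ∈ allFin q ] ∑[ v ∈ vectors d ] F (x ∷ v)
  ∑-vectors d F = ∑-cartesianProductWith _∷_ (allFin q) (vectors d) F

module _ {q : ℕ} .{{_ : NonZero q}} (m : ℕ) .{{_ : NonZero m}} (m∣q : m ℕ.∣ q) where

  -- Each coordinate admits q/m residues congruent to the given one; multiplying by `m ^ d` avoids
  -- the quotient.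
  ∑-congruent : ∀ {d} (v : Vec (ℤ/ q) d) →
                + (m ℕ.^ d) * (∑[ v′ ∈ vectors d ] ⟦ m ∣ v′ ⊖ v ⟧) ≡ + (q ℕ.^ d)
  ∑-congruent {zero}  []      = refl
  ∑-congruent {suc d} (x ∷ v) = begin
    + (m ℕ.^ suc d) * (∑[ v′ ∈ vectors (suc d) ] ⟦ m ∣ v′ ⊖ x ∷ v ⟧)
      ≡⟨ cong₂ _*_ (ℤ.pos-* m (m ℕ.^ d)) (∑-vectors d (λ v′ → ⟦ m ∣ v′ ⊖ x ∷ v ⟧)) ⟩
    + m * + (m ℕ.^ d) * (∑[ x′ ∈ allFin q ] ∑[ v′ ∈ vectors d ] ⟦ + m ∣ ι x′ - ι x ⟧ * ⟦ m ∣ v′ ⊖ v ⟧)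
      ≡⟨ cong (+ m * + (m ℕ.^ d) *_) (∑-product (allFin q) (vectors d) (λ x′ → ⟦ + m ∣ ι x′ - ι x ⟧) (λ v′ → ⟦ m ∣ v′ ⊖ v ⟧)) ⟨
    + m * + (m ℕ.^ d) * (count₁ * countᵈ)
      ≡⟨ interchange (+ m) (+ (m ℕ.^ d)) count₁ countᵈ ⟩
    + m * count₁ * (+ (m ℕ.^ d) * countᵈ)
      ≡⟨ cong₂ _*_ one-coordinate (∑-congruent v) ⟩
    + q * + (q ℕ.^ d)
      ≡⟨ ℤ.pos-* q (q ℕ.^ d) ⟨
    + (q ℕ.^ suc d) ∎
    where
    open ≡-Reasoning
    interchange : ∀ a b c d → a * b * (c * d) ≡ a * c * (b * d)
    interchange = solve-∀
    count₁ = ∑[ x′ ∈ allFin q ] ⟦ + m ∣ ι x′ - ι x ⟧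
    countᵈ = ∑[ v′ ∈ vectors d ] ⟦ m ∣ v′ ⊖ v ⟧
    one-coordinate : + m * count₁ ≡ + q
    one-coordinate = begin
      + m * count₁
        ≡⟨ ∑-distribˡ-* (allFin q) (+ m) (λ x′ → ⟦ + m ∣ ι x′ - ι x ⟧) ⟨
      ∑[ x′ ∈ allFin q ] comb m (ι x′ - ι x)
        ≡⟨ ∑-tabulate q (λ a → comb m (+ a - ι x)) ⟩
      ∑[ a ∈ upTo q ] comb m (+ a - ι x)
        ≡⟨ ∑-shift {comb m} q (period-comb m q m∣q) (- ι x) ⟩
      ∑[ a ∈ upTo q ] comb m (+ a)
        ≡⟨ ∑-comb q m m∣q ⟩
      + q ∎

  module _ (halve : ∀ u → + m ∣ u + u → + m ∣ u) where

    -- One coordinate at a time: the argument is affine in the coordinate `a` of `w`, with slope -2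
    -- (x′ - x), so `∑-c-linear` leaves the condition that `m` divides 2 (x′ - x), and `halve`
    -- removes the 2. The free summand `u` absorbs the coordinates already treated.
    ∑-c-φ : ∀ {d} (v′ v : Vec (ℤ/ q) d) u →
            ∑[ w ∈ vectors d ] c m (u + (φ v′ w - φ v w)) ≡ + (q ℕ.^ d) * (⟦ m ∣ v′ ⊖ v ⟧ * c m u)
    ∑-c-φ {zero} [] [] u = begin
      c m (u + 0ℤ) + 0ℤ       ≡⟨ ℤ.+-identityʳ _ ⟩
      c m (u + 0ℤ)            ≡⟨ cong (c m) (ℤ.+-identityʳ u) ⟩
      c m u                   ≡⟨ ℤ.*-identityˡ (c m u) ⟨
      1ℤ * c m u              ≡⟨ ℤ.*-identityˡ (1ℤ * c m u) ⟨
      1ℤ * (1ℤ * c m u)       ∎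
      where open ≡-Reasoning
    ∑-c-φ {suc d} (x′ ∷ v′) (x ∷ v) u = begin
      ∑[ w ∈ vectors (suc d) ] c m (u + (φ (x′ ∷ v′) w - φ (x ∷ v) w))
        ≡⟨ ∑-vectors d (λ w → c m (u + (φ (x′ ∷ v′) w - φ (x ∷ v) w))) ⟩
      ∑[ a ∈ allFin q ] ∑[ w ∈ vectors d ] c m (u + (φ (x′ ∷ v′) (a ∷ w) - φ (x ∷ v) (a ∷ w)))
        ≡⟨ ∑-cong (allFin q) (λ a → trans
             (∑-cong (vectors d) (λ w → cong (c m) (separate u (ι x′) (ι x) (ι a) (φ v′ w) (φ v w))))
             (∑-c-φ v′ v (u₁ - ι a * δ₂))) ⟩
      ∑[ a ∈ allFin q ] Q * (i * c m (u₁ - ι a * δ₂))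
        ≡⟨ ∑-distribˡ-* (allFin q) Q (λ a → i * c m (u₁ - ι a * δ₂)) ⟩
      Q * (∑[ a ∈ allFin q ] i * c m (u₁ - ι a * δ₂))
        ≡⟨ cong (Q *_) (∑-distribˡ-* (allFin q) i (λ a → c m (u₁ - ι a * δ₂))) ⟩
      Q * (i * (∑[ a ∈ allFin q ] c m (u₁ - ι a * δ₂)))
        ≡⟨ cong (λ s → Q * (i * s)) (trans (∑-tabulate q (λ a → c m (u₁ - + a * δ₂))) (∑-c-linear q m m∣q δ₂ u₁)) ⟩
      Q * (i * (+ q * (⟦ + m ∣ δ₂ ⟧ * c m u₁)))
        -- Where `m` divides `δ`, it divides x′² - x² as well, so `u₁` may be replaced by `u`.
        ≡⟨ cong (λ s → Q * (i * (+ q * s))) (trans (cong (_* c m u₁) (⟦∣⟧-⇔ {+ m} {δ₂} {+ m} {δ}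
             (λ m∣δ₂ → halve δ (subst (+ m ∣_) (double (ι x′) (ι x)) m∣δ₂))
             (λ m∣δ → subst (+ m ∣_) (sym (double (ι x′) (ι x))) (∣m∣n⇒∣m+n m∣δ m∣δ))))
             (⟦∣⟧*-cong (λ m∣δ → c-cong m u₁ u (subst (+ m ∣_) (factor u (ι x′) (ι x)) (∣n⇒∣m*n (ι x′ + ι x) m∣δ))))) ⟩
      Q * (i * (+ q * (⟦ + m ∣ δ ⟧ * c m u)))
        ≡⟨ reorder Q i (+ q) ⟦ + m ∣ δ ⟧ (c m u) ⟩
      + q * Q * (⟦ + m ∣ δ ⟧ * i * c m u)
        ≡⟨ cong (_* (⟦ + m ∣ δ ⟧ * i * c m u)) (ℤ.pos-* q (q ℕ.^ d)) ⟨
      + (q ℕ.^ suc d) * (⟦ + m ∣ δ ⟧ * i * c m u) ∎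
      where
      open ≡-Reasoning
      Q = + (q ℕ.^ d)
      i = ⟦ m ∣ v′ ⊖ v ⟧
      δ = ι x′ - ι x
      δ₂ = (ι x′ + ι x′) - (ι x + ι x)
      u₁ = u + (ι x′ * ι x′ - ι x * ι x)
      separate : ∀ u x′ x a p′ p →
        u + ((x′ * x′ - a * (x′ + x′) + p′) - (x * x - a * (x + x) + p)) ≡
        u + (x′ * x′ - x * x) - a * ((x′ + x′) - (x + x)) + (p′ - p)
      separate = solve-∀
      double : ∀ x′ x → (x′ + x′) - (x + x) ≡ x′ - x + (x′ - x)
      double = solve-∀
      factor : ∀ u x′ x → (x′ + x) * (x′ - x) ≡ u + (x′ * x′ - x * x) - u
      factor = solve-∀
      reorder : ∀ Q i q j c → Q * (i * (q * (j * c))) ≡ q * Q * (j * i * c)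
      reorder = solve-∀

-- The bound for S(m) by Cauchy-Schwarz.

∑-residue : ∀ {h} m .{{_ : NonZero m}} → Period h (+ m) → (∀ u → 0ℤ ≤ h u) →
            ∀ u → h u ≤ ∑[ b ∈ upTo m ] h (+ b)
∑-residue {h} m pm h≥0 u = begin
  h u                                   ≡⟨ cong h (a≡a%ℕn+[a/ℕn]*n u m) ⟩
  h (+ r + (u /ℕ m) * + m)              ≡⟨ period-* {h} (u /ℕ m) pm (+ r) ⟩
  h (+ r)                               ≡⟨ ℤ.+-identityʳ (h (+ r)) ⟨
  ∑[ b ∈ r ∷ [] ] h (+ b)               ≤⟨ ∑-⊆ (r ∷ []) (upTo m) (λ b → h≥0 (+ b)) (All.[] ∷ [])
                                             (λ { (here refl) → ∈-upTo⁺ (n%ℕd<d u m) }) ⟩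
  ∑[ b ∈ upTo m ] h (+ b)               ∎
  where
  open ℤ.≤-Reasoning
  r = u %ℕ m

module _ {q d : ℕ} .{{_ : NonZero q}} (E : List (Vec (ℤ/ q) d)) (E! : Unique E) (t : ℤ) where

  S : ℕ → ℤ
  S m = ∑[ w ∈ E ] ∑[ v ∈ E ] c m (dist v w - t)

  -- dist v w = φ v w + normSq w is decoupled by summing over every residue in place of
  -- t - normSq w, and over every vector w in place of those in E.
  module _ (m : ℕ) .{{_ : NonZero m}} (m∣q : m ℕ.∣ q) (halve : ∀ u → + m ∣ u + u → + m ∣ u) where

    private
      N = + length E
      Q = + (q ℕ.^ d)

      K : Vec (ℤ/ q) d → ℤ → ℤ
      K w b = ∑[ v ∈ E ] c m (φ v w - b)

      T W : ℤ
      T = ∑[ w ∈ E ] K w (t - normSq w) * K w (t - normSq w)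
      W = ∑[ w ∈ vectors d ] ∑[ b ∈ upTo m ] K w (+ b) * K w (+ b)

      S≡∑K : S m ≡ ∑[ w ∈ E ] K w (t - normSq w)
      S≡∑K = ∑-cong E (λ w → ∑-cong E (λ v → cong (c m)
        (trans (cong (_- t) (dist-φ v w)) (move (φ v w) (normSq w) t))))
        where
        move : ∀ a s t → a + s - t ≡ a - (t - s)
        move = solve-∀

      T≤W : T ≤ W
      T≤W = begin
        T
          ≤⟨ ∑-mono E (λ w → ∑-residue {λ b → K w b * K w b} m (K²-period w) (λ b → square-nonneg (K w b)) (t - normSq w)) ⟩
        ∑[ w ∈ E ] ∑[ b ∈ upTo m ] K w (+ b) * K w (+ b)
          ≤⟨ ∑-⊆ E (vectors d) (λ w → ∑-nonneg (upTo m) (λ b → square-nonneg (K w (+ b)))) E! (λ {w} _ → ∈-vectors w) ⟩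
        W ∎
        where
        open ℤ.≤-Reasoning
        K-period : ∀ w → Period (K w) (+ m)
        K-period w b = ∑-cong E (λ v → period-reflect {c m} m (φ v w) (period-c m m ℕ.∣-refl) b)
        K²-period : ∀ w → Period (λ b → K w b * K w b) (+ m)
        K²-period w b = cong₂ _*_ (K-period w b) (K-period w b)

      -- Once the square is opened, the correlation formula evaluates the sum over `b` and `∑-c-φ`,
      -- started at `u` = 0, the sum over `w`.
      W-value : W ≡ ∑[ v ∈ E ] ∑[ v′ ∈ E ] + m * (Q * (⟦ m ∣ v′ ⊖ v ⟧ * c m 0ℤ))
      W-value = begin
        W
          ≡⟨ ∑-cong (vectors d) (λ w → trans
               (∑-cong (upTo m) (λ b → ∑-product E E (λ v → c m (φ v w - + b)) (λ v′ → c m (φ v′ w - + b))))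
               (∑-rotate (upTo m) E E (λ b v v′ → c m (φ v w - + b) * c m (φ v′ w - + b)))) ⟩
        ∑[ w ∈ vectors d ] ∑[ v ∈ E ] ∑[ v′ ∈ E ] ∑[ b ∈ upTo m ] c m (φ v w - + b) * c m (φ v′ w - + b)
          ≡⟨ ∑-rotate (vectors d) E E _ ⟩
        ∑[ v ∈ E ] ∑[ v′ ∈ E ] ∑[ w ∈ vectors d ] ∑[ b ∈ upTo m ] c m (φ v w - + b) * c m (φ v′ w - + b)
          ≡⟨ ∑-cong E (λ v → ∑-cong E (λ v′ → pair v v′)) ⟩
        ∑[ v ∈ E ] ∑[ v′ ∈ E ] + m * (Q * (⟦ m ∣ v′ ⊖ v ⟧ * c m 0ℤ)) ∎
        where
        open ≡-Reasoning
        pair : ∀ v v′ → ∑[ w ∈ vectors d ] ∑[ b ∈ upTo m ] c m (φ v w - + b) * c m (φ v′ w - + b)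
                        ≡ + m * (Q * (⟦ m ∣ v′ ⊖ v ⟧ * c m 0ℤ))
        pair v v′ = begin
          ∑[ w ∈ vectors d ] ∑[ b ∈ upTo m ] c m (φ v w - + b) * c m (φ v′ w - + b)
            ≡⟨ ∑-cong (vectors d) (λ w → trans (∑-c-correlation m (φ v w) (φ v′ w))
                 (cong (λ u → + m * c m u) (sym (ℤ.+-identityˡ (φ v′ w - φ v w))))) ⟩
          ∑[ w ∈ vectors d ] + m * c m (0ℤ + (φ v′ w - φ v w))
            ≡⟨ ∑-distribˡ-* (vectors d) (+ m) (λ w → c m (0ℤ + (φ v′ w - φ v w))) ⟩
          + m * (∑[ w ∈ vectors d ] c m (0ℤ + (φ v′ w - φ v w)))
            ≡⟨ cong (+ m *_) (∑-c-φ m m∣q halve v′ v 0ℤ) ⟩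
          + m * (Q * (⟦ m ∣ v′ ⊖ v ⟧ * c m 0ℤ)) ∎

      -- For each `v`, at most (q/m)^d of the distinct vectors `v′` in `E` are congruent to it
      -- modulo `m`, and each contributes at most m Q m, because `c m 0ℤ` is at most `m`.
      W-bound : + (m ℕ.^ d) * W ≤ N * (+ m * Q * + m * Q)
      W-bound = begin
        + (m ℕ.^ d) * W
          ≡⟨ cong (+ (m ℕ.^ d) *_) W-value ⟩
        + (m ℕ.^ d) * (∑[ v ∈ E ] ∑[ v′ ∈ E ] + m * (Q * (⟦ m ∣ v′ ⊖ v ⟧ * c m 0ℤ)))
          ≡⟨ ∑-distribˡ-* E (+ (m ℕ.^ d)) (λ v → ∑[ v′ ∈ E ] + m * (Q * (⟦ m ∣ v′ ⊖ v ⟧ * c m 0ℤ))) ⟨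
        ∑[ v ∈ E ] + (m ℕ.^ d) * (∑[ v′ ∈ E ] + m * (Q * (⟦ m ∣ v′ ⊖ v ⟧ * c m 0ℤ)))
          ≤⟨ ∑-mono E row ⟩
        ∑[ v ∈ E ] + m * Q * + m * Q
          ≡⟨ ∑-const E (+ m * Q * + m * Q) ⟩
        N * (+ m * Q * + m * Q) ∎
        where
        open ℤ.≤-Reasoning
        regroup : ∀ m Q i c → m * (Q * (i * c)) ≡ m * Q * c * i
        regroup = solve-∀
        instance
          mQc≥0 : ℤ.NonNegative (+ m * Q * c m 0ℤ)
          mQc≥0 = ℤ.nonNegative (subst (λ i → 0ℤ ≤ i * c m 0ℤ) (ℤ.pos-* m (q ℕ.^ d))
            (subst (_≤ + (m ℕ.* q ℕ.^ d) * c m 0ℤ) (ℤ.*-zeroʳ (+ (m ℕ.* q ℕ.^ d)))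
              (ℤ.*-monoˡ-≤-nonNeg (+ (m ℕ.* q ℕ.^ d)) (c-0-nonneg m))))
        row : ∀ v → + (m ℕ.^ d) * (∑[ v′ ∈ E ] + m * (Q * (⟦ m ∣ v′ ⊖ v ⟧ * c m 0ℤ))) ≤ + m * Q * + m * Q
        row v = begin
          + (m ℕ.^ d) * (∑[ v′ ∈ E ] + m * (Q * (⟦ m ∣ v′ ⊖ v ⟧ * c m 0ℤ)))
            ≡⟨ cong (+ (m ℕ.^ d) *_) (trans (∑-cong E (λ v′ → regroup (+ m) Q ⟦ m ∣ v′ ⊖ v ⟧ (c m 0ℤ)))
                 (∑-distribˡ-* E (+ m * Q * c m 0ℤ) (λ v′ → ⟦ m ∣ v′ ⊖ v ⟧))) ⟩
          + (m ℕ.^ d) * (+ m * Q * c m 0ℤ * (∑[ v′ ∈ E ] ⟦ m ∣ v′ ⊖ v ⟧))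
            ≡⟨ x∙yz≈y∙xz (+ (m ℕ.^ d)) (+ m * Q * c m 0ℤ) (∑[ v′ ∈ E ] ⟦ m ∣ v′ ⊖ v ⟧) ⟩
          + m * Q * c m 0ℤ * (+ (m ℕ.^ d) * (∑[ v′ ∈ E ] ⟦ m ∣ v′ ⊖ v ⟧))
            ≤⟨ ℤ.*-monoˡ-≤-nonNeg (+ m * Q * c m 0ℤ) (ℤ.*-monoˡ-≤-nonNeg (+ (m ℕ.^ d))
                 (∑-⊆ E (vectors d) (λ v′ → ⟦∣⊖⟧-nonneg m v′ v) E! (λ {v′} _ → ∈-vectors v′))) ⟩
          + m * Q * c m 0ℤ * (+ (m ℕ.^ d) * (∑[ v′ ∈ vectors d ] ⟦ m ∣ v′ ⊖ v ⟧))
            ≡⟨ cong (+ m * Q * c m 0ℤ *_) (∑-congruent m m∣q v) ⟩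
          + m * Q * c m 0ℤ * Q
            ≤⟨ ℤ.*-monoʳ-≤-nonNeg Q (subst (λ i → i * c m 0ℤ ≤ i * + m) (ℤ.pos-* m (q ℕ.^ d))
                 (ℤ.*-monoˡ-≤-nonNeg (+ (m ℕ.* q ℕ.^ d)) (c-0-≤ m))) ⟩
          + m * Q * + m * Q ∎

    -- Cauchy-Schwarz over `w` gives S(m)² ≤ N T ≤ N W. The factor m² stays on the right until d ≥ 2
    -- is available to cancel it against `m ℕ.^ d`.
    S-bound : + (m ℕ.^ d) * (S m * S m) ≤ (+ m * + m) * ((N * N) * (Q * Q))
    S-bound = begin
      + (m ℕ.^ d) * (S m * S m)
        ≡⟨ cong (λ s → + (m ℕ.^ d) * (s * s)) S≡∑K ⟩
      + (m ℕ.^ d) * (ΣK * ΣK)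
        ≤⟨ ℤ.*-monoˡ-≤-nonNeg (+ (m ℕ.^ d)) (ℤ.≤-trans (cauchy-schwarz E (λ w → K w (t - normSq w)))
             (ℤ.*-monoˡ-≤-nonNeg N T≤W)) ⟩
      + (m ℕ.^ d) * (N * W)
        ≡⟨ x∙yz≈y∙xz (+ (m ℕ.^ d)) N W ⟩
      N * (+ (m ℕ.^ d) * W)
        ≤⟨ ℤ.*-monoˡ-≤-nonNeg N W-bound ⟩
      N * (N * (+ m * Q * + m * Q))
        ≡⟨ regroup N (+ m) Q ⟩
      (+ m * + m) * ((N * N) * (Q * Q)) ∎
      where
      open ℤ.≤-Reasoning
      ΣK = ∑[ w ∈ E ] K w (t - normSq w)
      regroup : ∀ N m Q → N * (N * (m * Q * m * Q)) ≡ (m * m) * ((N * N) * (Q * Q))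
      regroup = solve-∀

-- Rough numbers: no nontrivial divisor below a given bound.

prime-divisor : ∀ n .{{_ : NonTrivial n}} → ∃[ r ] (Prime r × r ℕ.∣ n)
prime-divisor n = go (factors prime-factors) (isFactorisation prime-factors) (factorsPrime prime-factors)
  where
  open PrimeFactorisation
  prime-factors = factorise n {{nonTrivial⇒nonZero n}}
  go : ∀ rs → n ≡ product rs → All.All Prime rs → ∃[ r ] (Prime r × r ℕ.∣ n)
  go []       n≡1 _           = contradiction n≡1 (nonTrivial⇒≢1 {n})
  go (r ∷ rs) n≡  (r-prime ∷ _) = r , r-prime , subst (r ℕ.∣_) (sym n≡) (ℕ.m∣m*n (product rs))

-- A nontrivial divisor of the product below `p` has a prime factor, also below `p`, which divides
-- `m` or `n` by Euclid's lemma.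
rough-* : ∀ {p} m n → p Rough m → p Rough n → p Rough (m ℕ.* n)
rough-* m n m-rough n-rough (ℕ.hasNonTrivialDivisor {e} e<p e∣mn)
  with r , r-prime , r∣e ← prime-divisor e
  with r<p ← ℕ.≤-<-trans (ℕ.∣⇒≤ {{nonTrivial⇒nonZero e}} r∣e) e<p
  with euclidsLemma m n r-prime (ℕ.∣-trans r∣e e∣mn)
... | inj₁ r∣m = m-rough (ℕ.hasNonTrivialDivisor {{prime⇒nonTrivial r-prime}} r<p r∣m)
... | inj₂ r∣n = n-rough (ℕ.hasNonTrivialDivisor {{prime⇒nonTrivial r-prime}} r<p r∣n)

rough-^ : ∀ {p} m k → p Rough m → p Rough (m ^ k)
rough-^ {p} m zero    _       = rough-1 p
rough-^     m (suc k) m-rough = rough-* m (m ^ k) m-rough (rough-^ m k m-rough)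

rough-∏ : ∀ {p} n (g : Fin n → ℕ) → (∀ i → p Rough g i) → p Rough ∏ g
rough-∏ {p} zero    g _       = rough-1 p
rough-∏     (suc n) g g-rough = rough-* (g zero) (∏ (g ∘ Fin.suc)) (g-rough zero)
                                  (rough-∏ n (g ∘ Fin.suc) (g-rough ∘ Fin.suc))

rough-≤ : ∀ {p q n} → p ℕ.≤ q → q Rough n → p Rough n
rough-≤ p≤q n-rough (ℕ.hasNonTrivialDivisor e<p e∣n) =
  n-rough (ℕ.hasNonTrivialDivisor (ℕ.<-≤-trans e<p p≤q) e∣n)

-- Roughness beyond 2 makes `m` coprime to 2, so the factor 2 cancels.
rough⇒halve : ∀ {p m} → 2 < p → p Rough m → ∀ u → + m ∣ u + u → + m ∣ u
rough⇒halve {p} {m} 2<p m-rough u m∣2u = ∣ᵤ⇒∣ (coprime-divisor m-odd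
  (subst (m ℕ.∣_) (ℤ.abs-* (+ 2) u) (∣⇒∣ᵤ (subst (+ m ∣_) (double u) m∣2u))))
  where
  double : ∀ u → u + u ≡ + 2 * u
  double = solve-∀
  m-odd : Coprime m 2
  m-odd {zero}        (_ , 0∣2) = contradiction (ℕ.0∣⇒≡0 0∣2) (λ ())
  m-odd {suc zero}    _         = refl
  m-odd {suc (suc e)} (e∣m , e∣2) =
    contradiction (ℕ.hasNonTrivialDivisor (ℕ.≤-<-trans (ℕ.∣⇒≤ e∣2) 2<p) e∣m) m-rough

-- Residue arithmetic compared with integer arithmetic modulo q.

module _ {q : ℕ} .{{_ : NonZero q}} where

  mod-≈ : ∀ n → + q ∣ + toℕ (n mod q) - + n
  mod-≈ n = divides (- + (n ℕ./ q)) (begin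
    + toℕ (n mod q) - + n                          ≡⟨ cong (λ r → + r - + n) (toℕ-fromℕ< _) ⟩
    + r - + n                                      ≡⟨ cong (λ k → + r - k) (trans (cong +_ (m≡m%n+[m/n]*n n q))
                                                        (cong (_+_ (+ r)) (ℤ.pos-* (n ℕ./ q) q))) ⟩
    + r - (+ r + + (n ℕ./ q) * + q)                ≡⟨ cancel (+ r) (+ (n ℕ./ q)) (+ q) ⟩
    - + (n ℕ./ q) * + q                            ∎)
    where
    open ≡-Reasoning
    r = n ℕ.% q
    cancel : ∀ r k q → r - (r + k * q) ≡ - k * q
    cancel = solve-∀

  -- Since `toℕ y` is below `q`, the natural number reduced in `x -ₘ y` exceeds the integer
  -- difference by exactly `q`; hence the added `∣-refl`.
  -ₘ-≈ : ∀ (x y : ℤ/ q) → + q ∣ ι (x -ₘ y) - (ι x - ι y)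
  -ₘ-≈ x y = subst (+ q ∣_) identity (∣m∣n⇒∣m+n (mod-≈ (toℕ x ℕ.+ (q ℕ.∸ toℕ y))) ∣-refl)
    where
    cancel : ∀ a x y q → a - (x + (q - y)) + q ≡ a - (x - y)
    cancel = solve-∀
    identity : ι (x -ₘ y) - + (toℕ x ℕ.+ (q ℕ.∸ toℕ y)) + + q ≡ ι (x -ₘ y) - (ι x - ι y)
    identity = trans (cong (λ k → ι (x -ₘ y) - (ι x + k) + + q)
                 (trans (sym (ℤ.⊖-≥ (ℕ.<⇒≤ (toℕ<n y)))) (sym (ℤ.m-n≡m⊖n q (toℕ y)))))
                 (cancel (ι (x -ₘ y)) (ι x) (ι y) (+ q))

  -- Four multiples of `q` add up to the difference: the errors of reducing the sum and the square,
  -- δ² - s² = (δ + s)(δ - s) with s the integer difference, and the error of the tail.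
  ‖‖-≈ : ∀ {d} (v w : Vec (ℤ/ q) d) → + q ∣ ι ‖ zipWith _-ₘ_ v w ‖ - dist v w
  ‖‖-≈ []      []      = mod-≈ 0
  ‖‖-≈ (x ∷ v) (y ∷ w) = subst (+ q ∣_) (combine (ι (δ² +ₘ R)) (ι δ²) (ι R) (ι δ) (ι x - ι y) (dist v w))
    (∣m∣n⇒∣m+n (∣m∣n⇒∣m+n (∣m∣n⇒∣m+n (mod-≈ (toℕ δ² ℕ.+ toℕ R)) square) (∣n⇒∣m*n (ι δ + (ι x - ι y)) (-ₘ-≈ x y))) (‖‖-≈ v w))
    where
    δ = x -ₘ y
    δ² = δ *ₘ δ
    R = ‖ zipWith _-ₘ_ v w ‖
    square : + q ∣ ι δ² - ι δ * ι δ
    square = subst (λ k → + q ∣ ι δ² - k) (ℤ.pos-* (toℕ δ) (toℕ δ)) (mod-≈ (toℕ δ ℕ.* toℕ δ))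
    combine : ∀ T M N δ s D → T - (M + N) + (M - δ * δ) + (δ + s) * (δ - s) + (N - D) ≡ T - (s * s + D)
    combine = solve-∀

  -- Representatives lie below `q`, so a positive difference of two of them is too small to be a
  -- multiple of `q`.
  ι-injective-≈ : (a b : ℤ/ q) → + q ∣ ι a - ι b → a ≡ b
  ι-injective-≈ a b q∣a-b = toℕ-injective (ℕ.≤-antisym
    (≤-of a b q∣a-b) (≤-of b a (∣-difference-sym (ι a) (ι b) q∣a-b)))
    where
    ≤-of : (a b : ℤ/ q) → + q ∣ ι a - ι b → toℕ a ℕ.≤ toℕ b
    ≤-of a b q∣a-b with toℕ a ℕ.≤? toℕ b
    ... | yes a≤b = a≤b
    ... | no  a≰b = contradiction (subst (q ℕ.∣_) (cong ∣_∣ (trans (ℤ.m-n≡m⊖n (toℕ a) (toℕ b)) (ℤ.⊖-≥ b≤a))) (∣⇒∣ᵤ q∣a-b))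
      (ℕ.>⇒∤ {{ℕ.>-nonZero (ℕ.m<n⇒0<n∸m (ℕ.≰⇒> a≰b))}} (ℕ.≤-<-trans (ℕ.m∸n≤m (toℕ a) (toℕ b)) (toℕ<n a)))
      where
      b≤a = ℕ.<⇒≤ (ℕ.≰⇒> a≰b)

-- The divisor list behind `τ`, and the size condition in ℕ.

∑-filter : ∀ {A : Set} {P : A → Set} (P? : ∀ x → Dec (P x)) (xs : List A) (F : A → ℤ) →
           ∑ (filter P? xs) F ≡ ∑[ x ∈ xs ] indicator (P? x) * F x
∑-filter P? []       F = refl
∑-filter P? (x ∷ xs) F with P? x
... | yes _ = cong₂ _+_ (sym (ℤ.*-identityˡ (F x))) (∑-filter P? xs F)
... | no  _ = trans (∑-filter P? xs F) (trans (sym (ℤ.+-identityˡ rest)) (cong (_+ rest) (sym (ℤ.*-zeroˡ (F x)))))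
  where rest = ∑[ x ∈ xs ] indicator (P? x) * F x

-- `applyUpTo suc (pred q)` is the tail of `upTo q`, so a single `filter` step separates the divisor
-- 1 from the list counted by `τ`.
divisors>1 : ℕ → List ℕ
divisors>1 q = filter (ℕ._∣? q) (map suc (applyUpTo suc (pred q)))

divisors-split : ∀ q .{{_ : NonZero q}} → filter (ℕ._∣? q) (map suc (upTo q)) ≡ 1 ∷ divisors>1 q
divisors-split q@(suc k) = filter-accept (ℕ._∣? q) (ℕ.1∣ q)

∈-divisors>1 : ∀ {q e} → e ∈ divisors>1 q → 1 < e × e ℕ.∣ q
∈-divisors>1 {q} e∈ with e∈′ , e∣q ← ∈-filter⁻ (ℕ._∣? q) {xs = map suc (applyUpTo suc (pred q))} e∈
  with _ , i∈ , refl ← ∈-map⁻ suc e∈′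
  with _ , _ , refl ← ∈-applyUpTo⁻ suc i∈ = s≤s (s≤s z≤n) , e∣q

∑∣-divisors : ∀ q .{{_ : NonZero q}} A → ∑∣ q A ≡ A 1 + ∑ (divisors>1 q) A
∑∣-divisors q A = begin
  ∑∣ q A                                                    ≡⟨ ∑-map suc (upTo q) (λ e → ⟦ + e ∣ + q ⟧ * A e) ⟨
  ∑[ e ∈ map suc (upTo q) ] ⟦ + e ∣ + q ⟧ * A e             ≡⟨ ∑-filter (ℕ._∣? q) (map suc (upTo q)) A ⟨
  ∑ (filter (ℕ._∣? q) (map suc (upTo q))) A                 ≡⟨ cong (λ xs → ∑ xs A) (divisors-split q) ⟩
  A 1 + ∑ (divisors>1 q) A                                  ∎
  where open ≡-Reasoning

-- `fromℕ` builds a normalised fraction. Both sides are therefore moved to unnormalised rationals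
-- with denominator 1, where the order is that of the numerators.
largeEnough⇒≤ : ∀ d q p size → LargeEnough 1ℚ d q p size →
  (τ q ℕ.* q ^ d) ℕ.* (τ q ℕ.* q ^ d) ℕ.≤ size ^ 2 ℕ.* p ^ (d ℕ.∸ 2)
largeEnough⇒≤ d q p size large = ℤ.drop‿+≤+ (subst₂ _≤_
  (trans (ℤ.*-identityʳ (+ X * + X)) (sym (ℤ.pos-* X X))) (ℤ.*-identityʳ (+ Y))
  (ℚᵘ.drop-*≤* (ℚᵘ.≤-respˡ-≃ square (ℚᵘ.≤-respʳ-≃ (ℚ.toℚᵘ-fromℚᵘ (mkℚᵘ (+ Y) 0)) (ℚ.toℚᵘ-mono-≤ large)))))
  where
  X = τ q ℕ.* q ^ d
  Y = size ^ 2 ℕ.* p ^ (d ℕ.∸ 2)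
  bound≃ : toℚᵘ (1ℚ ℚ.* fromℕ X) ℚᵘ.≃ mkℚᵘ (+ X) 0
  bound≃ = ℚᵘ.≃-trans (ℚᵘ.≃-reflexive (cong toℚᵘ (ℚ.*-identityˡ (fromℕ X)))) (ℚ.toℚᵘ-fromℚᵘ (mkℚᵘ (+ X) 0))
  square : toℚᵘ ((1ℚ ℚ.* fromℕ X) ℚ.* (1ℚ ℚ.* fromℕ X)) ℚᵘ.≃ mkℚᵘ (+ X) 0 ℚᵘ.* mkℚᵘ (+ X) 0
  square = ℚᵘ.≃-trans (ℚ.toℚᵘ-homo-* (1ℚ ℚ.* fromℕ X) (1ℚ ℚ.* fromℕ X)) (ℚᵘ.*-cong bound≃ bound≃)

comb≢0⇒∣ : ∀ m u → comb m u ≢ 0ℤ → + m ∣ u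
comb≢0⇒∣ m u fu≢0 = decidable-stable (+ m ∣? u)
  (λ m∤u → fu≢0 (trans (cong (+ m *_) (⟦∣⟧-no m∤u)) (ℤ.*-zeroʳ (+ m))))

-- Main term against error term.

module _ {q d p : ℕ} .{{_ : NonZero q}} (2≤d : 2 ℕ.≤ d) (2<p : 2 < p) (q-rough : p Rough q)
         (E : List (Vec (ℤ/ q) d)) (E! : Unique E) (t : ℤ) where

  private
    N Q P : ℕ
    N = length E
    Q = q ^ d
    P = p ^ (d ℕ.∸ 2)

    R : ℤ
    R = + (N ℕ.* N ℕ.* (Q ℕ.* Q))

  S-1 : S E E! t 1 ≡ + (N ℕ.* N)
  S-1 = begin
    ∑[ w ∈ E ] ∑[ v ∈ E ] c 1 (dist v w - t)  ≡⟨ ∑-cong E (λ w → ∑-cong E (λ v → c-1 (dist v w - t))) ⟩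
    ∑[ w ∈ E ] ∑[ v ∈ E ] 1ℤ                  ≡⟨ ∑-cong E (λ w → trans (∑-const E 1ℤ) (ℤ.*-identityʳ (+ N))) ⟩
    ∑[ w ∈ E ] + N                            ≡⟨ ∑-const E (+ N) ⟩
    + N * + N                                 ≡⟨ ℤ.pos-* N N ⟨
    + (N ℕ.* N)                               ∎
    where open ≡-Reasoning

  -- Write m^d as m² m^(d-2) and cancel m²; a divisor of `q` above 1 is at least `p` by roughness,
  -- so `P` is at most m^(d-2).
  S²-bound : ∀ m → 1 < m → m ℕ.∣ q → + P * (S E E! t m * S E E! t m) ≤ R
  S²-bound 1               (s≤s ())
  S²-bound m@(suc (suc _)) 1<m m∣q = ℤ.≤-trans
    (ℤ.*-monoʳ-≤-nonNeg (s * s) {{ℤ.nonNegative (square-nonneg s)}} (+≤+ (ℕ.^-monoˡ-≤ (d ℕ.∸ 2) p≤m)))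
    (ℤ.*-cancelˡ-≤-pos (+ (m ^ (d ℕ.∸ 2)) * (s * s)) R (+ (m ℕ.* m)) (subst₂ _≤_ power bound
      (S-bound E E! t m m∣q (rough⇒halve 2<p m-rough))))
    where
    s = S E E! t m
    m-rough : p Rough m
    m-rough = rough∧∣⇒rough q-rough m∣q
    p≤m : p ℕ.≤ m
    p≤m = rough⇒≤ m-rough
    power : + (m ^ d) * (s * s) ≡ + (m ℕ.* m) * (+ (m ^ (d ℕ.∸ 2)) * (s * s))
    power = begin
      + (m ^ d) * (s * s)
        ≡⟨ cong (λ k → + (m ^ k) * (s * s)) (ℕ.m+[n∸m]≡n 2≤d) ⟨
      + (m ℕ.* (m ℕ.* m ^ (d ℕ.∸ 2))) * (s * s)
        ≡⟨ cong (λ k → + k * (s * s)) (ℕ.*-assoc m m (m ^ (d ℕ.∸ 2))) ⟨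
      + (m ℕ.* m ℕ.* m ^ (d ℕ.∸ 2)) * (s * s)
        ≡⟨ cong (_* (s * s)) (ℤ.pos-* (m ℕ.* m) (m ^ (d ℕ.∸ 2))) ⟩
      + (m ℕ.* m) * + (m ^ (d ℕ.∸ 2)) * (s * s)
        ≡⟨ ℤ.*-assoc (+ (m ℕ.* m)) (+ (m ^ (d ℕ.∸ 2))) (s * s) ⟩
      + (m ℕ.* m) * (+ (m ^ (d ℕ.∸ 2)) * (s * s)) ∎
      where open ≡-Reasoning
    bound : (+ m * + m) * ((+ N * + N) * (+ Q * + Q)) ≡ + (m ℕ.* m) * R
    bound = cong₂ _*_ (sym (ℤ.pos-* m m))
      (trans (cong₂ _*_ (sym (ℤ.pos-* N N)) (sym (ℤ.pos-* Q Q))) (sym (ℤ.pos-* (N ℕ.* N) (Q ℕ.* Q))))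

  private
    ds : List ℕ
    ds = divisors>1 q

    L : ℕ
    L = length ds

  -- Only the squares S(m)² are controlled, so Cauchy-Schwarz over the `L` divisors is used in place
  -- of the triangle inequality, and no square root appears.
  error-bound : + P * (∑ ds (S E E! t) * ∑ ds (S E E! t)) ≤ + (L ℕ.* L) * R
  error-bound = begin
    + P * (∑ ds S′ * ∑ ds S′)                      ≤⟨ ℤ.*-monoˡ-≤-nonNeg (+ P) (cauchy-schwarz ds S′) ⟩
    + P * (+ L * (∑[ m ∈ ds ] S′ m * S′ m))        ≡⟨ x∙yz≈y∙xz (+ P) (+ L) _ ⟩
    + L * (+ P * (∑[ m ∈ ds ] S′ m * S′ m))        ≡⟨ cong (+ L *_) (∑-distribˡ-* ds (+ P) (λ m → S′ m * S′ m)) ⟨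
    + L * (∑[ m ∈ ds ] + P * (S′ m * S′ m))        ≤⟨ ℤ.*-monoˡ-≤-nonNeg (+ L) (∑-mono-∈ ds (λ {m} m∈ →
                                                        let 1<m , m∣q = ∈-divisors>1 m∈ in S²-bound m 1<m m∣q)) ⟩
    + L * (∑[ m ∈ ds ] R)                          ≡⟨ cong (+ L *_) (∑-const ds R) ⟩
    + L * (+ L * R)                                ≡⟨ ℤ.*-assoc (+ L) (+ L) R ⟨
    + L * + L * R                                  ≡⟨ cong (_* R) (ℤ.pos-* L L) ⟨
    + (L ℕ.* L) * R                                ∎
    where
    open ℤ.≤-Reasoning
    S′ = S E E! t

  solutions : ℤ
  solutions = ∑[ w ∈ E ] ∑[ v ∈ E ] comb q (dist v w - t)

  solutions-split : solutions ≡ + (N ℕ.* N) + ∑ ds (S E E! t)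
  solutions-split = begin
    solutions
      ≡⟨ ∑-cong E (λ w → ∑-cong E (λ v → ∑∣-c q (dist v w - t))) ⟨
    ∑[ w ∈ E ] ∑[ v ∈ E ] ∑∣ q (λ e → c e (dist v w - t))
      ≡⟨ ∑-cong E (λ w → ∑∣-∑ q E (λ e v → c e (dist v w - t))) ⟨
    ∑[ w ∈ E ] ∑∣ q (λ e → ∑[ v ∈ E ] c e (dist v w - t))
      ≡⟨ ∑∣-∑ q E (λ e w → ∑[ v ∈ E ] c e (dist v w - t)) ⟨
    ∑∣ q (S E E! t)
      ≡⟨ ∑∣-divisors q (S E E! t) ⟩
    S E E! t 1 + ∑ ds (S E E! t)
      ≡⟨ cong (_+ ∑ ds (S E E! t)) S-1 ⟩
    + (N ℕ.* N) + ∑ ds (S E E! t) ∎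
    where open ≡-Reasoning

  -- Without solutions the error term is -N², so its square is N⁴.
  no-solutions⇒≤ : solutions ≡ 0ℤ → P ℕ.* (N ℕ.* N ℕ.* (N ℕ.* N)) ℕ.≤ L ℕ.* L ℕ.* (N ℕ.* N ℕ.* (Q ℕ.* Q))
  no-solutions⇒≤ solutions≡0 = ℤ.drop‿+≤+ (subst₂ _≤_ lhs
    (sym (ℤ.pos-* (L ℕ.* L) (N ℕ.* N ℕ.* (Q ℕ.* Q)))) error-bound)
    where
    open ≡-Reasoning
    X = ∑ ds (S E E! t)
    squares : ∀ a x → a + x ≡ 0ℤ → x * x ≡ a * a
    squares a x a+x≡0 = begin
      x * x                              ≡⟨ expand a x ⟩
      a * a + (a + x) * (x - a)          ≡⟨ cong (λ k → a * a + k * (x - a)) a+x≡0 ⟩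
      a * a + 0ℤ * (x - a)               ≡⟨ simplify a (x - a) ⟩
      a * a                              ∎
      where
      expand : ∀ a x → x * x ≡ a * a + (a + x) * (x - a)
      expand = solve-∀
      simplify : ∀ a y → a * a + 0ℤ * y ≡ a * a
      simplify = solve-∀
    lhs : + P * (X * X) ≡ + (P ℕ.* (N ℕ.* N ℕ.* (N ℕ.* N)))
    lhs = begin
      + P * (X * X)
        ≡⟨ cong (+ P *_) (squares (+ (N ℕ.* N)) X (trans (sym solutions-split) solutions≡0)) ⟩
      + P * (+ (N ℕ.* N) * + (N ℕ.* N))
        ≡⟨ cong (+ P *_) (ℤ.pos-* (N ℕ.* N) (N ℕ.* N)) ⟨
      + P * + (N ℕ.* N ℕ.* (N ℕ.* N))
        ≡⟨ ℤ.pos-* P (N ℕ.* N ℕ.* (N ℕ.* N)) ⟨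
      + (P ℕ.* (N ℕ.* N ℕ.* (N ℕ.* N))) ∎

  -- Otherwise, with τ(q) = L + 1 and one factor N² cancelled, (L + 1)² Q² ≤ N² P ≤ L² Q², which is
  -- absurd as Q is positive.
  solutions≢0 : LargeEnough 1ℚ d q p N → solutions ≢ 0ℤ
  solutions≢0 large solutions≡0 =
    incompatible (N ℕ.* N) (no-solutions⇒≤ solutions≡0) (subst₂ ℕ._≤_ lhs rhs (largeEnough⇒≤ d q p N large))
    where
    instance
      Q≢0 : NonZero Q
      Q≢0 = ℕ.m^n≢0 q d
      Q²≢0 : NonZero (Q ℕ.* Q)
      Q²≢0 = ℕ.m*n≢0 Q Q
    τ≡ : τ q ≡ suc L
    τ≡ = cong length (divisors-split q)
    lhs : (τ q ℕ.* Q) ℕ.* (τ q ℕ.* Q) ≡ suc L ℕ.* suc L ℕ.* (Q ℕ.* Q)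
    lhs = trans (cong (λ k → (k ℕ.* Q) ℕ.* (k ℕ.* Q)) τ≡) (ℕ.[m*n]*[o*p]≡[m*o]*[n*p] (suc L) Q (suc L) Q)
    rhs : N ^ 2 ℕ.* P ≡ N ℕ.* N ℕ.* P
    rhs = cong (λ k → N ℕ.* k ℕ.* P) (ℕ.*-identityʳ N)
    incompatible : ∀ A → P ℕ.* (A ℕ.* A) ℕ.≤ L ℕ.* L ℕ.* (A ℕ.* (Q ℕ.* Q)) →
                   suc L ℕ.* suc L ℕ.* (Q ℕ.* Q) ℕ.≤ A ℕ.* P → ⊥
    -- Here `E` is empty, so N² cannot be cancelled; the size condition itself fails, its left side
    -- being positive.
    incompatible zero      _  le₂ = contradiction (ℕ.n≤0⇒n≡0 le₂) (ℕ.≢-nonZero⁻¹ _ {{ℕ.m*n≢0 (suc L ℕ.* suc L) (Q ℕ.* Q)}})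
    incompatible A@(suc _) le₁ le₂ = ℕ.<⇒≱ (ℕ.*-mono-< (ℕ.n<1+n L) (ℕ.n<1+n L))
      (ℕ.*-cancelʳ-≤ (suc L ℕ.* suc L) (L ℕ.* L) (Q ℕ.* Q) (ℕ.≤-trans le₂
        (ℕ.*-cancelˡ-≤ A (subst₂ ℕ._≤_ (rotate P A) (commute (L ℕ.* L) A (Q ℕ.* Q)) le₁))))
      where
      rotate : ∀ P A → P ℕ.* (A ℕ.* A) ≡ A ℕ.* (A ℕ.* P)
      rotate P A = trans (ℕ.*-comm P (A ℕ.* A)) (ℕ.*-assoc A A P)
      commute : ∀ a b c → a ℕ.* (b ℕ.* c) ≡ b ℕ.* (a ℕ.* c)
      commute a b c = trans (sym (ℕ.*-assoc a b c)) (trans (cong (ℕ._* c) (ℕ.*-comm a b)) (ℕ.*-assoc b a c))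

  attained : LargeEnough 1ℚ d q p N → ∃[ v ] ∃[ w ] (v ∈ E × w ∈ E × + q ∣ dist v w - t)
  attained large =
    let w , w∈E , row≢0  = ∑≢0⇒∃ E (solutions≢0 large)
        v , v∈E , term≢0 = ∑≢0⇒∃ E row≢0
    in v , w , v∈E , w∈E , comb≢0⇒∣ q (dist v w - t) term≢0

-- Passage to the distance set.

theorem1p5 : (d : ℕ) → 2 < d →
    ∃[ C ] (0ℚ <ℚ C ×
    ((q : ℕ) .{{_ : NonZero q}} (k-1 : ℕ) (p α : Fin (suc k-1) → ℕ) →
    (∀ i → Prime (p i)) →
    2 < p zero →
    (∀ i j → i <ᶠ j → p i < p j) →
    (∀ i → 0 < α i) →
    q ≡ ∏ (λ i → p i ^ α i) →
    (E : List (Vec (ℤ/ q) d)) → Unique E →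
    LargeEnough C d q (p zero) (length E) →
    Δ E ≐ U))
theorem1p5 d 2<d = 1ℚ , ℚ.positive⁻¹ 1ℚ , everyDistance
  where
  p₀≤ : ∀ {k-1} (p : Fin (suc k-1) → ℕ) → (∀ i j → i <ᶠ j → p i < p j) → ∀ i → p zero ℕ.≤ p i
  p₀≤ p increasing zero        = ℕ.≤-refl
  p₀≤ p increasing (Fin.suc i) = ℕ.<⇒≤ (increasing zero (Fin.suc i) (s≤s z≤n))

  everyDistance : (q : ℕ) .{{_ : NonZero q}} (k-1 : ℕ) (p α : Fin (suc k-1) → ℕ) →
    (∀ i → Prime (p i)) → 2 < p zero → (∀ i j → i <ᶠ j → p i < p j) → (∀ i → 0 < α i) →
    q ≡ ∏ (λ i → p i ^ α i) → (E : List (Vec (ℤ/ q) d)) → Unique E →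
    LargeEnough 1ℚ d q (p zero) (length E) → Δ E ≐ U
  everyDistance q k-1 p α p-prime 2<p₀ increasing _ q≡∏ E E! large = (λ _ → tt) , (λ {t} _ → attain t)
    where
    -- Every prime factor of `q` is at least the first one, so no nontrivial divisor of `q` lies
    -- below it.
    q-rough : p zero Rough q
    q-rough = subst (p zero Rough_) (sym q≡∏) (rough-∏ (suc k-1) (λ i → p i ^ α i) (λ i →
      rough-^ (p i) (α i) (rough-≤ (p₀≤ p increasing i) (prime⇒rough (p-prime i)))))
    telescope : ∀ t D n → t - D + (D - n) ≡ t - n
    telescope = solve-∀
    attain : ∀ t → Δ E t
    attain t =
      let v , w , v∈E , w∈E , q∣ = attained (ℕ.<⇒≤ 2<d) 2<p₀ q-rough E E! (ι t) large
          n = ‖ zipWith _-ₘ_ v w ‖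
      -- Modulo `q`, `t` is congruent to `dist v w`, hence to `n`; residues congruent modulo `q` are
      -- equal.
      in v , w , v∈E , w∈E , ι-injective-≈ t n (subst (+ q ∣_) (telescope (ι t) (dist v w) (ι n))
           (∣m∣n⇒∣m+n (∣-difference-sym (dist v w) (ι t) q∣) (∣-difference-sym (ι n) (dist v w) (‖‖-≈ v w))))
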